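{- Let $G$ be a simple graph on $n$ vertices with adjacency matrix $A$ and walk matrix $W(G)=[e,Ae,\ldots,A^{n-1}e]$, and assume $G$ is controllable, i.e. $\det W(G)\neq 0$. Let $p$ be an odd prime such that $\operatorname{rank}_p W(G)=n-1$. Then $$v_p(L(G))\le \tfrac{1}{2}\, v_p(\det W(G)).$$
   Context: $e$ denotes the all-ones vector. $\operatorname{rank}_p M$ is the rank of an integral matrix $M$ over the field $\mathbb{Z}/p\mathbb{Z}$. For a prime $p$ and nonzero integer $m$, $v_p(m)$ is the largest nonnegative integer $s$ with $p^s\mid m$. An orthogonal matrix is regular if each row sums to $1$; $\mathrm{RO}_n(\mathbb{Q})$ denotes the group of rational regular orthogonal $n\times n$ matrices. For a controllable graph $G$ with adjacency matrix $A$, $\mathcal{Q}(G)=\{Q\in \mathrm{RO}_n(\mathbb{Q}) : Q^{\mathsf T}AQ \text{ is a }(0,1)\text{ -matrix}\}$. The level $\ell(Q)$ of a rational matrix $Q$ is the smallest positive integer $k$ such that $kQ$ is integral. $L(G)=\operatorname{lcm}\{\ell(Q): Q\in\mathcal{Q}(G)\}$. -}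

module Defs where

open import Data.Nat as ℕ using (ℕ; zero; suc; _<_; _≤_)
open import Data.Nat.Divisibility as ℕD using ()
open import Data.Integer as ℤ using (ℤ; +_; -[1+_])
open import Data.Integer.Divisibility as ℤD using ()
open import Data.Rational as ℚ using (ℚ; 0ℚ; 1ℚ)
open import Data.Fin using (Fin; zero; suc; toℕ; punchIn; _≟_)
open import Data.Bool using (Bool; true; false)
open import Data.Product using (Σ; ∃; ∃-syntax; _×_; _,_)
open import Data.Sum using (_⊎_)
open import Relation.Binary.PropositionalEquality using (_≡_)
open import Relation.Nullary using (¬_; yes; no)
open import Function.Definitions using (Injective)

Mat : Set → ℕ → ℕ → Set
Mat A m k = Fin m → Fin k → A

sumℤ : ∀ {n} → (Fin n → ℤ) → ℤ
sumℤ {zero}  f = + 0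
sumℤ {suc n} f = f zero ℤ.+ sumℤ (λ i → f (suc i))

sumℚ : ∀ {n} → (Fin n → ℚ) → ℚ
sumℚ {zero}  f = 0ℚ
sumℚ {suc n} f = f zero ℚ.+ sumℚ (λ i → f (suc i))

record SimpleGraph (n : ℕ) : Set where
  field
    adj    : Fin n → Fin n → Bool
    sym    : ∀ i j → adj i j ≡ adj j i
    irrefl : ∀ i → adj i i ≡ false
open SimpleGraph public

bool→ℤ : Bool → ℤ
bool→ℤ true  = + 1
bool→ℤ false = + 0

adjacency : ∀ {n} → SimpleGraph n → Mat ℤ n n
adjacency G i j = bool→ℤ (adj G i j)

walkVec : ∀ {n} → Mat ℤ n n → ℕ → Fin n → ℤ
walkVec A zero    i = + 1
walkVec A (suc k) i = sumℤ (λ j → A i j ℤ.* walkVec A k j)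

walkMatrix : ∀ {n} → SimpleGraph n → Mat ℤ n n
walkMatrix G i j = walkVec (adjacency G) (toℕ j) i

sign : ℕ → ℤ
sign zero          = + 1
sign (suc zero)    = -[1+ 0 ]
sign (suc (suc k)) = sign k

det : ∀ {n} → Mat ℤ n n → ℤ
det {zero}  M = + 1
det {suc n} M =
  sumℤ (λ j → sign (toℕ j) ℤ.* M zero j ℤ.* det (λ r c → M (suc r) (punchIn j c)))

controllable : ∀ {n} → SimpleGraph n → Set
controllable G = ¬ (det (walkMatrix G) ≡ + 0)

column : ∀ {m k} → Mat ℤ m k → Fin k → Fin m → ℤ
column M j i = M i j

LinIndepMod : ℕ → ∀ {m r} → (Fin r → Fin m → ℤ) → Set
LinIndepMod p {m} {r} v =
  (c : Fin r → ℤ) →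
  (∀ i → (+ p) ℤD.∣ sumℤ (λ j → c j ℤ.* v j i)) →
  ∀ j → (+ p) ℤD.∣ c j

IndepColumns : ℕ → ∀ {m k r} → Mat ℤ m k → (Fin r → Fin k) → Set
IndepColumns p M f = Injective _≡_ _≡_ f × LinIndepMod p (λ j → column M (f j))

RankMod : ℕ → ∀ {m k} → Mat ℤ m k → ℕ → Set
RankMod p {m} {k} M r =
  (Σ (Fin r → Fin k) λ f → IndepColumns p M f) ×
  (∀ s (f : Fin s → Fin k) → IndepColumns p M f → s ≤ r)

Valuation : ℕ → ℤ → ℕ → Set
Valuation p m s = ((+ (p ℕ.^ s)) ℤD.∣ m) × ¬ ((+ (p ℕ.^ suc s)) ℤD.∣ m)

ℤ→ℚ : ℤ → ℚ
ℤ→ℚ z = z ℚ./ 1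

transpose : ∀ {A : Set} {m k} → Mat A m k → Mat A k m
transpose M i j = M j i

_⊗_ : ∀ {m k l} → Mat ℚ m k → Mat ℚ k l → Mat ℚ m l
(M ⊗ N) i j = sumℚ (λ t → M i t ℚ.* N t j)

identity : ∀ {n} → Mat ℚ n n
identity i j with i ≟ j
... | yes _ = 1ℚ
... | no  _ = 0ℚ

IsOrthogonal : ∀ {n} → Mat ℚ n n → Set
IsOrthogonal Q = ∀ i j → (transpose Q ⊗ Q) i j ≡ identity i j

IsRegular : ∀ {n} → Mat ℚ n n → Set
IsRegular Q = ∀ i → sumℚ (λ j → Q i j) ≡ 1ℚ

IsRegularOrthogonal : ∀ {n} → Mat ℚ n n → Set
IsRegularOrthogonal Q = IsOrthogonal Q × IsRegular Q

IsIntegral : ℚ → Set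
IsIntegral q = ∃[ z ] q ≡ ℤ→ℚ z

IsIntegralMat : ∀ {m k} → Mat ℚ m k → Set
IsIntegralMat M = ∀ i j → IsIntegral (M i j)

Is01Mat : ∀ {m k} → Mat ℚ m k → Set
Is01Mat M = ∀ i j → (M i j ≡ 0ℚ) ⊎ (M i j ≡ 1ℚ)

scale : ∀ {m k} → ℕ → Mat ℚ m k → Mat ℚ m k
scale c M i j = ℤ→ℚ (+ c) ℚ.* M i j

IsLevel : ∀ {m k} → Mat ℚ m k → ℕ → Set
IsLevel M k = (0 < k) × IsIntegralMat (scale k M) ×
              (∀ k′ → 0 < k′ → k′ < k → ¬ IsIntegralMat (scale k′ M))

InQ : ∀ {n} → SimpleGraph n → Mat ℚ n n → Set
InQ G Q = IsRegularOrthogonal Q ×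
          Is01Mat (transpose Q ⊗ ((λ i j → ℤ→ℚ (adjacency G i j)) ⊗ Q))

IsLCM : (ℕ → Set) → ℕ → Set
IsLCM S L = (∀ k → S k → k ℕD.∣ L) ×
            (∀ M → (∀ k → S k → k ℕD.∣ M) → L ℕD.∣ M)

IsLG : ∀ {n} → SimpleGraph n → ℕ → Set
IsLG G L = IsLCM (λ k → ∃[ Q ] (InQ G Q × IsLevel Q k)) L

{-# OPTIONS --safe #-}

-- Let Z = ℓ Q be the primitive integral multiple of Q, let p^k divide ℓ (k ≥ 1), and put
-- q = p^k and w_j = A^j e.  All columns of Z are orthogonal to every w_j modulo q.  Pick a
-- column z with an entry z₀ prime to p, at position i₀ say.  Since rank_p W = n − 1, the
-- vectors w_0, …, w_{n−2} are independent modulo p, and together with the unit vector e_{i₀}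
-- they form a basis over the p-local integers.  If γ is the coordinate functional of e_{i₀},
-- then det W is γ(w_{n−1}) up to p-local units, so it suffices to show q² ∣ γ(w_{n−1}).
--
-- Modulo q the vectors z, A z and γ are all proportional, so B = z₀ A − (A z)_{i₀} kills z and
-- γ modulo q; and q² divides z·z = ℓ² and z·Az = ℓ² (QᵀAQ)_{cc}, hence also γ·Bz.  Expanding
-- γ·Bz = Bγ·z along the basis leaves only q² ∣ t γ(w_{n−1}), where t is the coordinate of z at
-- w_{n−2}.  Finally p ∤ t: otherwise B z ≡ 0 (mod p) would propagate divisibility by p from t
-- to all coordinates of z.
--
-- No localisation is formed: p-local identities are multiplied by a denominator d with p ∤ d.

module Submission where

open import Defs renaming (sym to adj-sym)
open import Data.Nat using (ℕ; suc; _+_; _*_; _≤_)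
open import Data.Nat.Primality using (Prime)
open import Data.Integer using (+_)
open import Relation.Binary.PropositionalEquality using (_≡_)
open import Relation.Nullary using (¬_)

open import Algebra.Bundles using (CommutativeMonoid)
import Algebra.Properties.CommutativeSemigroup as CommutativeSemigroupProperties
open import Data.Fin
  using (Fin; zero; suc; toℕ; fromℕ; inject₁; punchIn; punchOut; _≟_)
open import Data.Fin.Induction using (>-weakInduction)
import Data.Fin.Properties as Fin
open import Data.Integer as ℤ using (ℤ; 0ℤ; 1ℤ; -_)
  renaming (_+_ to _⊕_; _*_ to _·_; ∣_∣ to abs)
open import Data.Integer.Divisibility.Signed
import Data.Integer.Properties as ℤ
open import Data.Integer.Tactic.RingSolver using (solve-∀)
open import Data.Nat as ℕ using (zero; _<_; s≤s; z≤n)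
import Data.Nat.Divisibility as ℕD
open import Data.Nat.Primality
  using (euclidsLemma; ¬prime[0]; ¬prime[1]; prime⇒nonTrivial)
import Data.Nat.Properties as ℕ
open import Data.Product using (Σ; ∃-syntax; _×_; _,_; proj₁; proj₂)
open import Data.Rational as ℚ using (ℚ; toℚᵘ)
import Data.Rational.Properties as ℚ
open import Data.Rational.Unnormalised as ℚᵘ using (mkℚᵘ; *≡*)
import Data.Rational.Unnormalised.Properties as ℚᵘ
open import Data.Sum using (_⊎_; inj₁; inj₂; [_,_]′)
open import Function using (_∘_; id; case_of_)
open import Relation.Binary.PropositionalEquality
  using (_≢_; refl; sym; trans; cong; cong₂; subst; subst₂; module ≡-Reasoning)
open import Relation.Nullary using (yes; no; contradiction)
open ≡-Reasoning

private
  module ℕ* = CommutativeSemigroupProperties ℕ.*-commutativeSemigroup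
  module ℤ+ = CommutativeSemigroupProperties ℤ.+-commutativeSemigroup
  module ℤ* = CommutativeSemigroupProperties ℤ.*-commutativeSemigroup
  module ℚ* = CommutativeSemigroupProperties
    (CommutativeMonoid.commutativeSemigroup ℚ.*-1-commutativeMonoid)

  variable
    m n r : ℕ

-- Linear algebra over ℤ

sum-cong : {f g : Fin n → ℤ} → (∀ i → f i ≡ g i) → sumℤ f ≡ sumℤ g
sum-cong {zero}  eq = refl
sum-cong {suc n} eq = cong₂ _⊕_ (eq zero) (sum-cong (eq ∘ suc))

sum-zero : {f : Fin n → ℤ} → (∀ i → f i ≡ 0ℤ) → sumℤ f ≡ 0ℤ
sum-zero {zero}  eq = refl
sum-zero {suc n} eq = cong₂ _⊕_ (eq zero) (sum-zero (eq ∘ suc))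

sum-+ : (f g : Fin n → ℤ) → sumℤ (λ i → f i ⊕ g i) ≡ sumℤ f ⊕ sumℤ g
sum-+ {zero}  f g = refl
sum-+ {suc n} f g =
  trans (cong ((f zero ⊕ g zero) ⊕_) (sum-+ (f ∘ suc) (g ∘ suc)))
        (ℤ+.interchange (f zero) (g zero) (sumℤ (f ∘ suc)) (sumℤ (g ∘ suc)))

sum-* : ∀ x (f : Fin n → ℤ) → sumℤ (λ i → x · f i) ≡ x · sumℤ f
sum-* {zero}  x f = sym (ℤ.*-zeroʳ x)
sum-* {suc n} x f =
  trans (cong (x · f zero ⊕_) (sum-* x (f ∘ suc)))
        (sym (ℤ.*-distribˡ-+ x (f zero) (sumℤ (f ∘ suc))))

sum-linear : ∀ x y (f g : Fin n → ℤ) →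
             sumℤ (λ i → x · f i ⊕ y · g i) ≡ x · sumℤ f ⊕ y · sumℤ g
sum-linear x y f g =
  trans (sum-+ (λ i → x · f i) (λ i → y · g i)) (cong₂ _⊕_ (sum-* x f) (sum-* y g))

sum-swap : (f : Fin m → Fin n → ℤ) →
           sumℤ (λ i → sumℤ (f i)) ≡ sumℤ (λ j → sumℤ (λ i → f i j))
sum-swap {zero} {n} f = sym (sum-zero {n} (λ _ → refl))
sum-swap {suc m} f =
  trans (cong (sumℤ (f zero) ⊕_) (sum-swap (f ∘ suc)))
        (sym (sum-+ (f zero) (λ j → sumℤ (λ i → f (suc i) j))))

sum-∣ : ∀ {k} {f : Fin n → ℤ} → (∀ i → k ∣ f i) → k ∣ sumℤ f
sum-∣ {zero}  {k} k∣f = divides 0ℤ refl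
sum-∣ {suc n} k∣f = ∣m∣n⇒∣m+n (k∣f zero) (sum-∣ (k∣f ∘ suc))

sum-last : (f : Fin (suc n) → ℤ) → sumℤ f ≡ sumℤ (f ∘ inject₁) ⊕ f (fromℕ n)
sum-last {zero}  f = ℤ.+-comm (f zero) 0ℤ
sum-last {suc n} f =
  trans (cong (f zero ⊕_) (sum-last (f ∘ suc)))
        (sym (ℤ.+-assoc (f zero) (sumℤ (f ∘ suc ∘ inject₁)) _))

sum-punchIn : ∀ (j : Fin (suc n)) (f : Fin (suc n) → ℤ) →
              sumℤ f ≡ f j ⊕ sumℤ (f ∘ punchIn j)
sum-punchIn zero f = refl
sum-punchIn {suc n} (suc j) f =
  trans (cong (f zero ⊕_) (sum-punchIn j (f ∘ suc)))
        (ℤ+.x∙yz≈y∙xz (f zero) (f (suc j)) (sumℤ (f ∘ suc ∘ punchIn j)))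

-- Kronecker delta, dot products and linear combinations.

δ : Fin n → Fin n → ℤ
δ zero    zero    = 1ℤ
δ zero    (suc j) = 0ℤ
δ (suc i) zero    = 0ℤ
δ (suc i) (suc j) = δ i j

δ-refl : (i : Fin n) → δ i i ≡ 1ℤ
δ-refl zero    = refl
δ-refl (suc i) = δ-refl i

δ-≢ : {i j : Fin n} → i ≢ j → δ i j ≡ 0ℤ
δ-≢ {i = zero}  {zero}  i≢j = contradiction refl i≢j
δ-≢ {i = zero}  {suc j} i≢j = refl
δ-≢ {i = suc i} {zero}  i≢j = refl
δ-≢ {i = suc i} {suc j} i≢j = δ-≢ (i≢j ∘ cong suc)

δ-sym : (i j : Fin n) → δ i j ≡ δ j i
δ-sym zero    zero    = refl
δ-sym zero    (suc j) = refl
δ-sym (suc i) zero    = refl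
δ-sym (suc i) (suc j) = δ-sym i j

sum-δ : ∀ (i : Fin n) (f : Fin n → ℤ) → sumℤ (λ j → f j · δ i j) ≡ f i
sum-δ zero f =
  trans (cong₂ _⊕_ (ℤ.*-identityʳ (f zero)) (sum-zero (λ j → ℤ.*-zeroʳ (f (suc j)))))
        (ℤ.+-identityʳ (f zero))
sum-δ (suc i) f =
  trans (cong₂ _⊕_ (ℤ.*-zeroʳ (f zero)) (sum-δ i (f ∘ suc))) (ℤ.+-identityˡ _)

infix 7 _∙_

_∙_ : (u v : Fin n → ℤ) → ℤ
u ∙ v = sumℤ (λ i → u i · v i)

comb : (Fin r → ℤ) → (Fin r → Fin n → ℤ) → Fin n → ℤ
comb c v i = sumℤ (λ j → c j · v j i)

∙-comm : (u v : Fin n → ℤ) → u ∙ v ≡ v ∙ u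
∙-comm u v = sum-cong (λ i → ℤ.*-comm (u i) (v i))

∙-congʳ : ∀ (u : Fin n → ℤ) {v w} → (∀ i → v i ≡ w i) → u ∙ v ≡ u ∙ w
∙-congʳ u eq = sum-cong (λ i → cong (u i ·_) (eq i))

∙-linearʳ : ∀ x y (u v w : Fin n → ℤ) →
            u ∙ (λ i → x · v i ⊕ y · w i) ≡ x · (u ∙ v) ⊕ y · (u ∙ w)
∙-linearʳ x y u v w =
  trans (sum-cong (λ i → rearrange x y (u i) (v i) (w i)))
        (sum-linear x y (λ i → u i · v i) (λ i → u i · w i))
  where
  rearrange : ∀ x y a b c → a · (x · b ⊕ y · c) ≡ x · (a · b) ⊕ y · (a · c)
  rearrange = solve-∀

∙-comb : (u : Fin n → ℤ) (c : Fin r → ℤ) (v : Fin r → Fin n → ℤ) →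
         u ∙ comb c v ≡ c ∙ (λ j → u ∙ v j)
∙-comb u c v = begin
  sumℤ (λ i → u i · sumℤ (λ j → c j · v j i))
    ≡⟨ sum-cong (λ i → sym (sum-* (u i) (λ j → c j · v j i))) ⟩
  sumℤ (λ i → sumℤ (λ j → u i · (c j · v j i)))
    ≡⟨ sum-swap (λ i j → u i · (c j · v j i)) ⟩
  sumℤ (λ j → sumℤ (λ i → u i · (c j · v j i)))
    ≡⟨ sum-cong (λ j → trans (sum-cong (λ i → ℤ*.x∙yz≈y∙xz (u i) (c j) (v j i)))
                             (sum-* (c j) (λ i → u i · v j i))) ⟩
  sumℤ (λ j → c j · (u ∙ v j)) ∎

comb-* : ∀ x (c : Fin r → ℤ) (v : Fin r → Fin n → ℤ) i →
         comb (λ j → x · c j) v i ≡ x · comb c v i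
comb-* x c v i =
  trans (sum-cong (λ j → ℤ.*-assoc x (c j) (v j i))) (sum-* x (λ j → c j · v j i))

comb-linear : ∀ x y (c e : Fin r → ℤ) (v : Fin r → Fin n → ℤ) i →
              comb (λ j → x · c j ⊕ y · e j) v i ≡ x · comb c v i ⊕ y · comb e v i
comb-linear x y c e v i =
  trans (sum-cong (λ j → rearrange x y (c j) (e j) (v j i)))
        (sum-linear x y (λ j → c j · v j i) (λ j → e j · v j i))
  where
  rearrange : ∀ x y a b c → (x · a ⊕ y · b) · c ≡ x · (a · c) ⊕ y · (b · c)
  rearrange = solve-∀

-- Integer dependences and dual systems of vectors.

IsRelation : (Fin r → ℤ) → (Fin r → Fin n → ℤ) → Set
IsRelation c v = ∀ i → comb c v i ≡ 0ℤ

-- Fraction-free Gaussian elimination, one coordinate at a time. If the first coordinate vanishes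
-- throughout it is dropped; otherwise a pivot vector clears it from all the others, and both counts
-- go down by one.
dependence : m < r → (v : Fin r → Fin m → ℤ) →
             ∃[ c ] (∃[ j ] c j ≢ 0ℤ) × IsRelation c v
dependence {zero} {suc r} _ v = (λ _ → 1ℤ) , (zero , λ ()) , λ ()
dependence {suc m} {suc r} (s≤s m<r) v with Fin.all? (λ j → v j zero ℤ.≟ 0ℤ)
... | yes v₀≡0 =
  let c , c≢0 , rel = dependence (ℕ.m<n⇒m<1+n m<r) (λ j → v j ∘ suc)
  in c , c≢0 , λ where
    zero    → sum-zero (λ j → trans (cong (c j ·_) (v₀≡0 j)) (ℤ.*-zeroʳ (c j)))
    (suc i) → rel i
... | no v₀≢0 = lift , (punchIn k (proj₁ c≢0) , lift≢0) , isRelation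
  where
  pivot = Fin.¬∀⟶∃¬ _ (λ j → v j zero ≡ 0ℤ) (λ j → v j zero ℤ.≟ 0ℤ) v₀≢0
  k = proj₁ pivot
  a = v k zero

  w : Fin r → Fin (suc m) → ℤ
  w j i = a · v (punchIn k j) i ⊕ - v (punchIn k j) zero · v k i

  ih = dependence m<r (λ j → w j ∘ suc)
  c = proj₁ ih
  c≢0 = proj₁ (proj₂ ih)

  w-relation : IsRelation c w
  w-relation zero    = sum-zero (λ j → cancel (c j) a (v (punchIn k j) zero))
    where
    cancel : ∀ c a b → c · (a · b ⊕ - b · a) ≡ 0ℤ
    cancel = solve-∀
  w-relation (suc i) = proj₂ (proj₂ ih) i

  -- The coefficient of the pivot vector, collecting the multiples of it that were subtracted in
  -- forming the `w j`.
  e = sumℤ (λ j → c j · - v (punchIn k j) zero)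

  lift : Fin (suc r) → ℤ
  lift j with k ≟ j
  ... | yes _   = e
  ... | no k≢j = c (punchOut k≢j) · a

  lift-k : lift k ≡ e
  lift-k with k ≟ k
  ... | yes _   = refl
  ... | no k≢k = contradiction refl k≢k

  lift-punchIn : ∀ j → lift (punchIn k j) ≡ c j · a
  lift-punchIn j with k ≟ punchIn k j
  ... | yes k≡  = contradiction (sym k≡) (Fin.punchInᵢ≢i k j)
  ... | no k≢j =
    cong (λ i → c i · a) (trans (Fin.punchOut-cong k refl) (Fin.punchOut-punchIn k))

  lift≢0 : lift (punchIn k (proj₁ c≢0)) ≢ 0ℤ
  lift≢0 eq =
    [ proj₂ c≢0 , proj₂ pivot ]′
      (ℤ.i*j≡0⇒i≡0∨j≡0 _ (trans (sym (lift-punchIn (proj₁ c≢0))) eq))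

  isRelation : IsRelation lift v
  isRelation i = begin
    sumℤ (λ j → lift j · v j i)
      ≡⟨ sum-punchIn k (λ j → lift j · v j i) ⟩
    lift k · v k i ⊕ sumℤ (λ j → lift (punchIn k j) · v (punchIn k j) i)
      ≡⟨ cong₂ _⊕_ (trans (cong (_· v k i) lift-k) (ℤ.*-comm e (v k i)))
                   (sum-cong (λ j → cong (_· v (punchIn k j) i) (lift-punchIn j))) ⟩
    v k i · e ⊕ sumℤ (λ j → c j · a · v (punchIn k j) i)
      ≡⟨ cong (_⊕ sumℤ (λ j → c j · a · v (punchIn k j) i))
              (sum-* (v k i) (λ j → c j · - v (punchIn k j) zero)) ⟨
    sumℤ (λ j → v k i · (c j · - v (punchIn k j) zero))
      ⊕ sumℤ (λ j → c j · a · v (punchIn k j) i)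
      ≡⟨ sum-+ (λ j → v k i · (c j · - v (punchIn k j) zero)) _ ⟨
    sumℤ (λ j → v k i · (c j · - v (punchIn k j) zero) ⊕ c j · a · v (punchIn k j) i)
      ≡⟨ sum-cong (λ j → regroup (c j) a (v (punchIn k j) i) (v (punchIn k j) zero) (v k i)) ⟩
    comb c w i
      ≡⟨ w-relation i ⟩
    0ℤ ∎
    where
    regroup : ∀ c a x b y → y · (c · - b) ⊕ c · a · x ≡ c · (a · x ⊕ - b · y)
    regroup = solve-∀

-- A dependence among the n + 1 vectors e_l, y_1, …, y_n expresses a multiple of e_l by the y_j.
dual-complete : ∀ {d} → d ≢ 0ℤ → (x y : Fin n → Fin n → ℤ) →
                (∀ i j → x i ∙ y j ≡ d · δ i j) →
                ∀ k l → sumℤ (λ j → y j k · x j l) ≡ d · δ k l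
dual-complete {n} {d} d≢0 x y dual k l = ℤ.*-cancelˡ-≡ c₀ _ _ {{ℤ.≢-nonZero c₀≢0}} (begin
  c₀ · sumℤ (λ j → y j k · x j l)
    ≡⟨ sum-* c₀ (λ j → y j k · x j l) ⟨
  sumℤ (λ j → c₀ · (y j k · x j l))
    ≡⟨ sum-cong (λ j → trans (ℤ*.x∙yz≈y∙xz c₀ (y j k) (x j l)) (cong (y j k ·_) (pairing j))) ⟩
  sumℤ (λ j → y j k · (- (d · c (suc j))))
    ≡⟨ sum-cong (λ j → swap₂ (y j k) d (c (suc j))) ⟩
  sumℤ (λ j → - d · (c (suc j) · y j k))
    ≡⟨ sum-* (- d) (λ j → c (suc j) · y j k) ⟩
  - d · s
    ≡⟨ swap₃ d c₀ (δ l k) s ⟩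
  c₀ · (d · δ l k) ⊕ - d · (c₀ · δ l k ⊕ s)
    ≡⟨ cong (λ t → c₀ · (d · δ l k) ⊕ - d · t) (relation k) ⟩
  c₀ · (d · δ l k) ⊕ - d · 0ℤ
    ≡⟨ swap₄ (c₀ · (d · δ l k)) d ⟩
  c₀ · (d · δ l k)
    ≡⟨ cong (λ t → c₀ · (d · t)) (δ-sym l k) ⟩
  c₀ · (d · δ k l) ∎)
  where
  v : Fin (suc n) → Fin n → ℤ
  v zero    = δ l
  v (suc j) = y j

  dep = dependence ℕ.≤-refl v
  c = proj₁ dep
  relation = proj₂ (proj₂ dep)
  c₀ = c zero
  s = sumℤ (λ j → c (suc j) · y j k)

  swap₂ : ∀ a b c → a · (- (b · c)) ≡ - b · (c · a)
  swap₂ = solve-∀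
  swap₃ : ∀ d c e s → - d · s ≡ c · (d · e) ⊕ - d · (c · e ⊕ s)
  swap₃ = solve-∀
  swap₄ : ∀ a d → a ⊕ - d · 0ℤ ≡ a
  swap₄ = solve-∀
  isolate : ∀ a b → a ≡ (a ⊕ b) ⊕ - b
  isolate = solve-∀

  -- Pairing the dependence with `x j` leaves, by duality, only the terms of `δ l` and `y j`.
  pairing : ∀ j → c₀ · x j l ≡ - (d · c (suc j))
  pairing j = begin
    c₀ · x j l
      ≡⟨ isolate (c₀ · x j l) (d · c (suc j)) ⟩
    (c₀ · x j l ⊕ d · c (suc j)) ⊕ - (d · c (suc j))
      ≡⟨ cong (_⊕ - (d · c (suc j))) (begin
        c₀ · x j l ⊕ d · c (suc j)
          ≡⟨ cong₂ _⊕_ (cong (c₀ ·_) (sum-δ l (x j)))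
               (trans (sum-cong (λ i → trans (cong (c (suc i) ·_) (dual j i))
                                             (ℤ*.x∙yz≈y∙xz (c (suc i)) d (δ j i))))
                      (trans (sum-* d (λ i → c (suc i) · δ j i))
                             (cong (d ·_) (sum-δ j (c ∘ suc))))) ⟨
        c ∙ (λ i → x j ∙ v i)
          ≡⟨ ∙-comb (x j) c v ⟨
        x j ∙ comb c v
          ≡⟨ sum-zero (λ i → trans (cong (x j i ·_) (relation i)) (ℤ.*-zeroʳ (x j i))) ⟩
        0ℤ ∎) ⟩
    0ℤ ⊕ - (d · c (suc j))
      ≡⟨ ℤ.+-identityˡ _ ⟩
    - (d · c (suc j)) ∎

  -- If `c₀` vanished, `pairing` would make every other coefficient vanish too, and the dependence
  -- would be trivial.
  c₀≢0 : c₀ ≢ 0ℤ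
  c₀≢0 c₀≡0 = proj₂ (proj₁ (proj₂ dep)) (vanish (proj₁ (proj₁ (proj₂ dep))))
    where
    vanish : ∀ j → c j ≡ 0ℤ
    vanish zero    = c₀≡0
    vanish (suc j) =
      [ (λ d≡0 → contradiction d≡0 d≢0) , id ]′ (ℤ.i*j≡0⇒i≡0∨j≡0 d (begin
        d · c (suc j)       ≡⟨ ℤ.neg-involutive _ ⟨
        - - (d · c (suc j)) ≡⟨ cong -_ (pairing j) ⟨
        - (c₀ · x j l)      ≡⟨ cong (λ t → - (t · x j l)) c₀≡0 ⟩
        0ℤ ∎))

-- The hypothesis resolves `d` times the identity as a sum of outer products of `y j` and `x j`;
-- contracting it with `v` gives the expansion.
dual-expand : ∀ {d} (x y : Fin r → Fin n → ℤ) →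
              (∀ i l → sumℤ (λ j → y j i · x j l) ≡ d · δ i l) →
              ∀ v l → d · v l ≡ comb (λ j → y j ∙ v) x l
dual-expand {d = d} x y complete v l = begin
  d · v l
    ≡⟨ cong (d ·_) (sum-δ l v) ⟨
  d · sumℤ (λ i → v i · δ l i)
    ≡⟨ sum-* d (λ i → v i · δ l i) ⟨
  sumℤ (λ i → d · (v i · δ l i))
    ≡⟨ sum-cong (λ i → trans (ℤ*.x∙yz≈y∙xz d (v i) (δ l i))
                             (cong (v i ·_) (complete′ i))) ⟩
  v ∙ comb (λ j → x j l) y
    ≡⟨ ∙-comb v (λ j → x j l) y ⟩
  sumℤ (λ j → x j l · (v ∙ y j))
    ≡⟨ sum-cong (λ j → trans (ℤ.*-comm (x j l) (v ∙ y j))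
                             (cong (_· x j l) (∙-comm v (y j)))) ⟩
  comb (λ j → y j ∙ v) x l ∎
  where
  complete′ : ∀ i → d · δ l i ≡ sumℤ (λ j → x j l · y j i)
  complete′ i = trans (cong (d ·_) (δ-sym l i))
    (trans (sym (complete i l)) (sum-cong (λ j → ℤ.*-comm (y j i) (x j l))))

-- Divisibility by a prime

module AtPrime (p : ℕ) (pp : Prime p) where

  π : ℤ
  π = + p

  p≢0 : p ≢ 0
  p≢0 refl = ¬prime[0] pp

  π∣*⇒ : ∀ {a b} → π ∣ a · b → π ∣ a ⊎ π ∣ b
  π∣*⇒ {a} {b} π∣ab
    with euclidsLemma (abs a) (abs b) pp (subst (p ℕD.∣_) (ℤ.abs-* a b) (∣⇒∣ᵤ π∣ab))
  ... | inj₁ p∣a = inj₁ (∣ᵤ⇒∣ p∣a)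
  ... | inj₂ p∣b = inj₂ (∣ᵤ⇒∣ p∣b)

  π-cancelˡ : ∀ {a b} → ¬ (π ∣ a) → π ∣ a · b → π ∣ b
  π-cancelˡ π∤a π∣ab = [ (λ π∣a → contradiction π∣a π∤a) , id ]′ (π∣*⇒ π∣ab)

  π∤* : ∀ {a b} → ¬ (π ∣ a) → ¬ (π ∣ b) → ¬ (π ∣ a · b)
  π∤* π∤a π∤b π∣ab = π∤b (π-cancelˡ π∤a π∣ab)

  π∤1 : ¬ (π ∣ 1ℤ)
  π∤1 π∣1 = ¬prime[1] (subst Prime (ℕD.∣1⇒≡1 (∣⇒∣ᵤ π∣1)) pp)

  π∤⇒≢0 : ∀ {a} → ¬ (π ∣ a) → a ≢ 0ℤ
  π∤⇒≢0 π∤a refl = π∤a (divides 0ℤ refl)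

  instance
    π-nonZero : ℤ.NonZero π
    π-nonZero = ℤ.≢-nonZero (p≢0 ∘ ℤ.+-injective)

  π^ : ℕ → ℤ
  π^ k = + (p ℕ.^ k)

  π^-suc : ∀ k → π^ (suc k) ≡ π · π^ k
  π^-suc k = ℤ.pos-* p (p ℕ.^ k)

  -- Induction on `k`: Euclid's lemma puts one factor `π` into `b`, and that factor is cancelled
  -- from both sides.
  π^-cancelˡ : ∀ k {a b} → ¬ (π ∣ a) → π^ k ∣ a · b → π^ k ∣ b
  π^-cancelˡ zero    {b = b} π∤a _ = divides b (sym (ℤ.*-identityʳ b))
  π^-cancelˡ (suc k) {a} {b} π∤a π^∣ab
    with π∣ππ^ ← subst (_∣ a · b) (π^-suc k) π^∣ab
    with divides b′ refl ← π-cancelˡ {b = b} π∤a (∣-trans (∣m⇒∣m*n (π^ k) ∣-refl) π∣ππ^) =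
    subst₂ _∣_ (sym (π^-suc k)) (ℤ.*-comm π b′)
      (*-monoʳ-∣ π (π^-cancelˡ k π∤a
        (*-cancelˡ-∣ π (subst (π · π^ k ∣_) (move a b′ π) π∣ππ^))))
    where
    move : ∀ a b c → a · (b · c) ≡ c · (a · b)
    move = solve-∀

  Primitive : (Fin r → ℤ) → Set
  Primitive c = ∃[ j ] ¬ (π ∣ c j)

  -- Only the `p`-part of the content is removed: as long as `π` divides all coordinates, they are
  -- divided by it. The absolute value of the nonzero coordinate `j` drops each time and bounds the
  -- number of rounds.
  primitivePart : (c : Fin r → ℤ) → (∃[ j ] c j ≢ 0ℤ) →
                  ∃[ c′ ] Primitive c′ × ∃[ x ] (x ≢ 0ℤ × ∀ j → c j ≡ x · c′ j)
  primitivePart {r} c (j , c≢0) = go (abs (c j)) c c≢0 ℕ.≤-refl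
    where
    go : ∀ bound (c : Fin r → ℤ) → c j ≢ 0ℤ → abs (c j) ≤ bound →
         ∃[ c′ ] Primitive c′ × ∃[ x ] (x ≢ 0ℤ × ∀ j → c j ≡ x · c′ j)
    go bound c c≢0 c≤bound with Fin.all? (λ j → π ∣? c j)
    ... | no ¬all =
      c , Fin.¬∀⟶∃¬ _ _ (λ j → π ∣? c j) ¬all , 1ℤ , (λ ()) , λ j → sym (ℤ.*-identityˡ (c j))
    go zero c c≢0 c≤0 | yes _ = contradiction (ℤ.∣i∣≡0⇒i≡0 (ℕ.n≤0⇒n≡0 c≤0)) c≢0
    go (suc bound) c c≢0 c≤bound | yes all =
      let c′ , prim , x , x≢0 , eq = go bound (λ i → quotient (all i)) q≢0 q≤bound
      in c′ , prim , π · x , πx≢0 x≢0 ,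
         λ i → trans (_∣_.equality (all i))
                     (trans (cong (_· π) (eq i)) (move x (c′ i) π))
      where
      move : ∀ a b c → a · b · c ≡ c · a · b
      move = solve-∀
      πx≢0 : ∀ {x} → x ≢ 0ℤ → π · x ≢ 0ℤ
      πx≢0 x≢0 πx≡0 = [ p≢0 ∘ ℤ.+-injective , x≢0 ]′ (ℤ.i*j≡0⇒i≡0∨j≡0 π πx≡0)
      q = quotient (all j)
      q≢0 : q ≢ 0ℤ
      q≢0 q≡0 = c≢0 (trans (_∣_.equality (all j)) (cong (_· π) q≡0))
      q≤bound : abs q ≤ bound
      q≤bound = ℕ.≤-pred (ℕ.<-≤-trans q<c c≤bound)
        where
        q<c : abs q < abs (c j)
        q<c = subst (abs q <_)
          (sym (trans (cong abs (_∣_.equality (all j))) (ℤ.abs-* q π)))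
          (ℕ.m<m*n (abs q) p {{ℕ.≢-nonZero (q≢0 ∘ ℤ.∣i∣≡0⇒i≡0)}} 
            (ℕ.nonTrivial⇒n>1 p {{prime⇒nonTrivial pp}}))

  -- Removing the common power of `p` keeps an integer dependence nontrivial modulo `p`, so that it
  -- can be played against `Indep`.
  primitive-dependence : m < r → (v : Fin r → Fin m → ℤ) →
                         ∃[ c ] Primitive c × IsRelation c v
  primitive-dependence m<r v =
    let c , c≢0 , rel = dependence m<r v
        c′ , prim , x , x≢0 , eq = primitivePart c c≢0
    in c′ , prim , λ i →
         [ (λ x≡0 → contradiction x≡0 x≢0) , id ]′ (ℤ.i*j≡0⇒i≡0∨j≡0 x (begin
           x · comb c′ v i           ≡⟨ comb-* x c′ v i ⟨
           comb (λ j → x · c′ j) v i ≡⟨ sum-cong (λ j → cong (_· v j i) (sym (eq j))) ⟩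
           comb c v i                ≡⟨ rel i ⟩
           0ℤ ∎))

  -- Independence modulo `p` and dual bases.

  Indep : (Fin r → Fin m → ℤ) → Set
  Indep {r} {m} v = (c : Fin r → ℤ) → (∀ i → π ∣ comb c v i) → ∀ j → π ∣ c j

  indep⇒≤ : (v : Fin r → Fin m → ℤ) → Indep v → r ≤ m
  indep⇒≤ v indep = ℕ.≮⇒≥ λ m<r →
    let c , (j , π∤c) , rel = primitive-dependence m<r v
    in π∤c (indep c (λ i → divides 0ℤ (rel i)) j)

  -- A common denominator: `x` is the product of all `d i`, and `e i` is the product of the others.
  commonMultiple : (d : Fin r → ℤ) → (∀ i → ¬ (π ∣ d i)) →
                   ∃[ x ] (¬ (π ∣ x) × Σ (Fin r → ℤ) λ e → ∀ i → x ≡ e i · d i)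
  commonMultiple {zero}  d π∤d = 1ℤ , π∤1 , (λ ()) , λ ()
  commonMultiple {suc r} d π∤d =
    let x , π∤x , e , eq = commonMultiple (d ∘ suc) (π∤d ∘ suc)
    in x · d zero , π∤* π∤x (π∤d zero) ,
       (λ { zero → x ; (suc i) → e i · d zero }) ,
       λ { zero    → refl
         ; (suc i) → trans (cong (_· d zero) (eq i)) (swap (e i) (d (suc i)) (d zero)) }
    where
    swap : ∀ a b c → a · b · c ≡ a · c · b
    swap = solve-∀

  -- The dual basis of `u` over the `p`-local integers, multiplied by a common denominator `d`. The
  -- fields `complete` and `dual` say that it is an inverse of `u` on either side.
  record DualBasis {n} (u : Fin n → Fin n → ℤ) : Set where
    field
      d        : ℤ
      π∤d      : ¬ (π ∣ d)
      y        : Fin n → Fin n → ℤ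
      complete : ∀ i l → sumℤ (λ j → y j i · u j l) ≡ d · δ i l
      dual     : ∀ j k → u j ∙ y k ≡ d · δ j k

  abstract
    -- Each unit vector `δ i` depends on the `n` vectors `u j`, with coefficients not all divisible
    -- by `p`. Solving for `δ i` and passing to a common denominator inverts `u`.
    dualBasis : (u : Fin n → Fin n → ℤ) → Indep u → DualBasis u
    dualBasis {n} u indep = record
      { d = d ; π∤d = proj₁ (proj₂ common) ; y = y ; complete = complete
      -- Applied to the transposes, `dual-complete` turns the inverse on one side into an inverse on
      -- the other.
      ; dual = dual-complete (π∤⇒≢0 (proj₁ (proj₂ common)))
                             (λ i j → y j i) (λ l j → u j l) complete }
      where
      v : Fin n → Fin (suc n) → Fin n → ℤ
      v i zero    = δ i
      v i (suc j) = u j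

      dep : ∀ i → ∃[ c ] Primitive c × IsRelation c (v i)
      dep i = primitive-dependence ℕ.≤-refl (v i)

      c : Fin n → Fin (suc n) → ℤ
      c i = proj₁ (dep i)

      relation : ∀ i l → c i zero · δ i l ⊕ sumℤ (λ j → c i (suc j) · u j l) ≡ 0ℤ
      relation i = proj₂ (proj₂ (dep i))

      -- If `π` divided the coefficient of `δ i`, independence of `u` would make it divide all the
      -- others, against primitivity.
      π∤c₀ : ∀ i → ¬ (π ∣ c i zero)
      π∤c₀ i π∣c₀ = proj₂ (proj₁ (proj₂ (dep i))) (all (proj₁ (proj₁ (proj₂ (dep i)))))
        where
        all : ∀ j → π ∣ c i j
        all zero    = π∣c₀
        all (suc j) = indep (c i ∘ suc)
          (λ l → ∣m+n∣m⇒∣n (divides 0ℤ (relation i l)) (∣m⇒∣m*n (δ i l) π∣c₀)) j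

      common : ∃[ x ] (¬ (π ∣ x) × Σ (Fin n → ℤ) λ e → ∀ i → x ≡ e i · c i zero)
      common = commonMultiple (λ i → c i zero) π∤c₀

      d : ℤ
      d = proj₁ common

      e : Fin n → ℤ
      e = proj₁ (proj₂ (proj₂ common))

      -- `y j i` is the coefficient of `u j` once the dependence is solved for `d · δ i`; the factor
      -- `e i` brings the denominator `c i zero` to the common `d`.
      y : Fin n → Fin n → ℤ
      y j i = - e i · c i (suc j)

      complete : ∀ i l → sumℤ (λ j → y j i · u j l) ≡ d · δ i l
      complete i l = begin
        comb (λ j → - e i · c i (suc j)) u l
          ≡⟨ comb-* (- e i) (c i ∘ suc) u l ⟩
        - e i · s
          ≡⟨ complete-square (e i) (c i zero) (δ i l) s ⟩
        e i · c i zero · δ i l ⊕ - e i · (c i zero · δ i l ⊕ s)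
          ≡⟨ cong₂ (λ a b → a · δ i l ⊕ - e i · b)
                   (sym (proj₂ (proj₂ (proj₂ common)) i)) (relation i l) ⟩
        d · δ i l ⊕ - e i · 0ℤ
          ≡⟨ drop (d · δ i l) (e i) ⟩
        d · δ i l ∎
        where
        s : ℤ
        s = comb (c i ∘ suc) u l
        complete-square : ∀ e c δ s → - e · s ≡ e · c · δ ⊕ - e · (c · δ ⊕ s)
        complete-square = solve-∀
        drop : ∀ a e → a ⊕ - e · 0ℤ ≡ a
        drop = solve-∀

-- Krylov sequences

-- Multiplication of a polynomial by its variable, on coefficient vectors and with the leading term
-- cut off; `comb-shift` returns that term separately.
shift : (Fin (suc r) → ℤ) → Fin (suc r) → ℤ
shift c zero    = 0ℤ
shift c (suc j) = c (inject₁ j)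

comb-shift : ∀ (c : Fin (suc r) → ℤ) (w : ℕ → Fin n → ℤ) i →
             comb c (λ j → w (suc (toℕ j))) i ≡
             comb (shift c) (λ j → w (toℕ j)) i ⊕ c (fromℕ r) · w (suc r) i
comb-shift {r} c w i = begin
  comb c (λ j → w (suc (toℕ j))) i
    ≡⟨ sum-last (λ j → c j · w (suc (toℕ j)) i) ⟩
  sumℤ (λ j → c (inject₁ j) · w (suc (toℕ (inject₁ j))) i)
    ⊕ c (fromℕ r) · w (suc (toℕ (fromℕ r))) i
    ≡⟨ cong₂ _⊕_ (sum-cong (λ j → cong (λ t → c (inject₁ j) · w (suc t) i) (Fin.toℕ-inject₁ j)))
                 (cong (λ t → c (fromℕ r) · w (suc t) i) (Fin.toℕ-fromℕ r)) ⟩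
  sumℤ (λ j → c (inject₁ j) · w (suc (toℕ j)) i) ⊕ c (fromℕ r) · w (suc r) i
    ≡⟨ cong (_⊕ c (fromℕ r) · w (suc r) i)
            (trans (cong (_⊕ tail) (ℤ.*-zeroˡ (w zero i))) (ℤ.+-identityˡ tail)) ⟨
  comb (shift c) (λ j → w (toℕ j)) i ⊕ c (fromℕ r) · w (suc r) i ∎
  where
  tail = sumℤ (λ j → c (inject₁ j) · w (suc (toℕ j)) i)

snoc-elim : {P : Fin (suc n) → Set} → (∀ j → P (inject₁ j)) → P (fromℕ n) → ∀ j → P j
snoc-elim {zero}  init last zero    = last
snoc-elim {suc n} init last zero    = init zero
snoc-elim {suc n} {P} init last (suc j) = snoc-elim {P = P ∘ suc} (init ∘ suc) last j

module Krylov (p : ℕ) (pp : Prime p) {n} (A : Mat ℤ n n) where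
  open AtPrime p pp

  w : ℕ → Fin n → ℤ
  w = walkVec A

  krylov : ∀ r → Fin r → Fin n → ℤ
  krylov r j = w (toℕ j)

  -- The multiplier `u`, prime to `p`, takes the place of division modulo `p`.
  record InSpan (r m : ℕ) : Set where
    constructor inSpan
    field
      u      : ℤ
      π∤u    : ¬ (π ∣ u)
      a      : Fin r → ℤ
      approx : ∀ i → π ∣ u · w m i ⊕ - comb a (krylov r) i

  -- Once `w r` lies in the span of its predecessors modulo `p`, that span is invariant under `A`
  -- and therefore contains every walk vector.
  span-closed : InSpan r r → ∀ m → InSpan r m
  span-closed {zero}  top zero = top
  span-closed {suc r} top zero = inSpan 1ℤ π∤1 (δ zero) λ i →
    divides 0ℤ (trans (cong (λ t → 1ℤ · 1ℤ ⊕ - t)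
                            (trans (sum-cong (λ j → ℤ.*-comm (δ zero j) (krylov (suc r) j i)))
                                   (sum-δ zero (λ j → krylov (suc r) j i))))
                      refl)
  span-closed {r} top (suc m) = step top (span-closed top m)
    where
    applied : ∀ {r m} (s : InSpan r m) i →
              π ∣ InSpan.u s · w (suc m) i ⊕ - comb (InSpan.a s) (λ j → w (suc (toℕ j))) i
    applied {r} {m} (inSpan u _ a approx) i =
      subst (π ∣_) eq (sum-∣ (λ k → ∣n⇒∣m*n (A i k) (approx k)))
      where
      eq : A i ∙ (λ k → u · w m k ⊕ - comb a (krylov r) k) ≡
           u · w (suc m) i ⊕ - comb a (λ j → w (suc (toℕ j))) i
      eq = begin
        A i ∙ (λ k → u · w m k ⊕ - comb a (krylov r) k)
          ≡⟨ ∙-congʳ (A i) (λ k → cong (u · w m k ⊕_) (sym (ℤ.-1*i≡-i (comb a (krylov r) k)))) ⟩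
        A i ∙ (λ k → u · w m k ⊕ - 1ℤ · comb a (krylov r) k)
          ≡⟨ ∙-linearʳ u (- 1ℤ) (A i) (w m) (comb a (krylov r)) ⟩
        u · w (suc m) i ⊕ - 1ℤ · (A i ∙ comb a (krylov r))
          ≡⟨ cong (u · w (suc m) i ⊕_) (trans (ℤ.-1*i≡-i _) (cong -_ (∙-comb (A i) a (krylov r)))) ⟩
        u · w (suc m) i ⊕ - comb a (λ j → w (suc (toℕ j))) i ∎

    step : ∀ {r m} → InSpan r r → InSpan r m → InSpan r (suc m)
    step {zero}  top s = inSpan u π∤u a (applied s)
      where open InSpan s
    step {suc r} {m} top s = inSpan (u₀ · u) (π∤* π∤u₀ π∤u) b λ i →
      subst (π ∣_) (eq i)
        (∣m∣n⇒∣m+n (∣n⇒∣m*n u₀ (applied s i)) (∣n⇒∣m*n (a (fromℕ r)) (approx₀ i)))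
      where
      open InSpan s
      open InSpan top renaming (u to u₀; π∤u to π∤u₀; a to a₀; approx to approx₀)
      -- Applying `A` shifts the coefficients `a`; the term in `w (suc r)` that overflows is
      -- replaced by its approximation from `top`, after multiplication by `u₀`.
      b : Fin (suc r) → ℤ
      b j = u₀ · shift a j ⊕ a (fromℕ r) · a₀ j
      K = krylov (suc r)
      regroup : ∀ u₀ u x s l t y → u₀ · (u · x ⊕ - (s ⊕ l · y)) ⊕ l · (u₀ · y ⊕ - t) ≡
                                   u₀ · u · x ⊕ - (u₀ · s ⊕ l · t)
      regroup = solve-∀
      eq : ∀ i → u₀ · (u · w (suc m) i ⊕ - comb a (λ j → w (suc (toℕ j))) i)
                   ⊕ a (fromℕ r) · (u₀ · w (suc r) i ⊕ - comb a₀ K i)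
                 ≡ u₀ · u · w (suc m) i ⊕ - comb b K i
      eq i = begin
        u₀ · (u · w (suc m) i ⊕ - comb a (λ j → w (suc (toℕ j))) i)
          ⊕ a (fromℕ r) · (u₀ · w (suc r) i ⊕ - comb a₀ K i)
          ≡⟨ cong (λ t → u₀ · (u · w (suc m) i ⊕ - t)
                           ⊕ a (fromℕ r) · (u₀ · w (suc r) i ⊕ - comb a₀ K i))
                  (comb-shift a w i) ⟩
        u₀ · (u · w (suc m) i ⊕ - (comb (shift a) K i ⊕ a (fromℕ r) · w (suc r) i))
          ⊕ a (fromℕ r) · (u₀ · w (suc r) i ⊕ - comb a₀ K i)
          ≡⟨ regroup u₀ u (w (suc m) i) (comb (shift a) K i) (a (fromℕ r)) (comb a₀ K i) (w (suc r) i) ⟩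
        u₀ · u · w (suc m) i ⊕ - (u₀ · comb (shift a) K i ⊕ a (fromℕ r) · comb a₀ K i)
          ≡⟨ cong (λ t → u₀ · u · w (suc m) i ⊕ - t)
                  (comb-linear u₀ (a (fromℕ r)) (shift a) a₀ K i) ⟨
        u₀ · u · w (suc m) i ⊕ - comb b K i ∎

  -- A relation modulo `p` among the coefficient vectors of the `w (f j)` becomes one among the
  -- `w (f j)` themselves. So the `m` coefficient vectors are independent, and they have length `r`.
  span⇒≤ : InSpan r r → (f : Fin m → ℕ) → Indep (λ j → w (f j)) → m ≤ r
  span⇒≤ {r} {m} top f indep = indep⇒≤ (InSpan.a ∘ s) λ c π∣c j →
    π-cancelˡ (InSpan.π∤u (s j)) (subst (π ∣_) (ℤ.*-comm (c j) (InSpan.u (s j)))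
      (indep (λ j → c j · InSpan.u (s j)) (combined c π∣c) j))
    where
    s : ∀ j → InSpan r (f j)
    s j = span-closed top (f j)
    combined : ∀ c → (∀ k → π ∣ comb c (InSpan.a ∘ s) k) →
               ∀ i → π ∣ comb (λ j → c j · InSpan.u (s j)) (λ j → w (f j)) i
    combined c π∣c i = subst (π ∣_) eq (∣m∣n⇒∣m+n
      (sum-∣ (λ j → ∣n⇒∣m*n (c j) (InSpan.approx (s j) i)))
      (sum-∣ (λ k → ∣n⇒∣m*n (krylov r k i) (π∣c k))))
      where
      K = λ k → krylov r k i
      expand : ∀ c u x y → c · (u · x ⊕ - y) ⊕ c · y ≡ c · u · x
      expand = solve-∀
      residual : Fin m → ℤ
      residual j = c j · (InSpan.u (s j) · w (f j) i ⊕ - comb (InSpan.a (s j)) (krylov r) i)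
      eq : sumℤ residual
             ⊕ (K ∙ comb c (InSpan.a ∘ s))
           ≡ comb (λ j → c j · InSpan.u (s j)) (λ j → w (f j)) i
      eq = begin
        sumℤ residual
          ⊕ (K ∙ comb c (InSpan.a ∘ s))
          ≡⟨ cong (sumℤ residual ⊕_) (trans (∙-comb K c (InSpan.a ∘ s))
                              (∙-congʳ c (λ j → ∙-comm K (InSpan.a (s j))))) ⟩
        sumℤ residual
          ⊕ sumℤ (λ j → c j · comb (InSpan.a (s j)) (krylov r) i)
          ≡⟨ sum-+ residual (λ j → c j · comb (InSpan.a (s j)) (krylov r) i) ⟨
        sumℤ (λ j → residual j ⊕ c j · comb (InSpan.a (s j)) (krylov r) i)
          ≡⟨ sum-cong (λ j → expand (c j) (InSpan.u (s j)) (w (f j) i)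
                                    (comb (InSpan.a (s j)) (krylov r) i)) ⟩
        comb (λ j → c j · InSpan.u (s j)) (λ j → w (f j)) i ∎

  -- A walk vector dependent on its predecessors would put the whole sequence in their span.
  krylov-indep : (f : Fin m → ℕ) → Indep (λ j → w (f j)) → ∀ r → r ≤ m → Indep (krylov r)
  krylov-indep f indep zero    _   c π∣c ()
  krylov-indep {m} f indep (suc r) r<m c π∣c = snoc-elim (ih (c ∘ inject₁) init∣) π∣last
    where
    ih = krylov-indep f indep r (ℕ.<⇒≤ r<m)
    split : ∀ i → comb c (krylov (suc r)) i ≡
                  comb (c ∘ inject₁) (krylov r) i ⊕ c (fromℕ r) · w r i
    split i = trans (sum-last (λ j → c j · w (toℕ j) i))
      (cong₂ _⊕_ (sum-cong (λ j → cong (λ t → c (inject₁ j) · w t i) (Fin.toℕ-inject₁ j)))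
                 (cong (λ t → c (fromℕ r) · w t i) (Fin.toℕ-fromℕ r)))
    neg : ∀ x y → x ⊕ y ≡ y ⊕ - (- 1ℤ · x)
    neg = solve-∀
    π∣last : π ∣ c (fromℕ r)
    π∣last with π ∣? c (fromℕ r)
    ... | yes π∣l = π∣l
    ... | no  π∤l = contradiction (span⇒≤ top f indep) (ℕ.<⇒≱ r<m)
      where
      isolate : ∀ i → comb c (krylov (suc r)) i ≡
                c (fromℕ r) · w r i ⊕ - comb (λ j → - 1ℤ · c (inject₁ j)) (krylov r) i
      isolate i = trans (split i)
        (trans (neg (comb (c ∘ inject₁) (krylov r) i) (c (fromℕ r) · w r i))
               (cong (λ t → c (fromℕ r) · w r i ⊕ - t)
                     (sym (comb-* (- 1ℤ) (c ∘ inject₁) (krylov r) i))))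
      top : InSpan r r
      top = inSpan (c (fromℕ r)) π∤l (λ j → - 1ℤ · c (inject₁ j))
                   (λ i → subst (π ∣_) (isolate i) (π∣c i))
    init∣ : ∀ i → π ∣ comb (c ∘ inject₁) (krylov r) i
    init∣ i = ∣m+n∣n⇒∣m (subst (π ∣_) (split i) (π∣c i)) (∣m⇒∣m*n (w r i) π∣last)

-- Determinants

minor : Mat ℤ (suc n) (suc n) → Fin (suc n) → Mat ℤ n n
minor M c i k = M (suc i) (punchIn c k)

det-cong : {M N : Mat ℤ n n} → (∀ i j → M i j ≡ N i j) → det M ≡ det N
det-cong {zero}  eq = refl
det-cong {suc n} eq = sum-cong (λ c →
  cong₂ _·_ (cong (sign (toℕ c) ·_) (eq zero c)) (det-cong (λ i k → eq (suc i) (punchIn c k))))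

-- In each term of the expansion along the first row exactly one factor depends on column `j`: the
-- entry if `c` is `j`, and otherwise the minor, to which induction applies.
det-linear : ∀ (j : Fin n) x y (M M₁ M₂ : Mat ℤ n n) →
             (∀ i k → k ≢ j → M i k ≡ M₁ i k) →
             (∀ i k → k ≢ j → M i k ≡ M₂ i k) →
             (∀ i → M i j ≡ x · M₁ i j ⊕ y · M₂ i j) →
             det M ≡ x · det M₁ ⊕ y · det M₂
det-linear {suc n} j x y M M₁ M₂ eq₁ eq₂ eq =
  trans (sum-cong term)
        (sum-linear x y (λ c → sign (toℕ c) · M₁ zero c · det (minor M₁ c))
                        (λ c → sign (toℕ c) · M₂ zero c · det (minor M₂ c)))
  where
  entry-linear : ∀ s x y a b e → s · (x · a ⊕ y · b) · e ≡ x · (s · a · e) ⊕ y · (s · b · e)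
  entry-linear = solve-∀
  minor-linear : ∀ s x y a e f → s · a · (x · e ⊕ y · f) ≡ x · (s · a · e) ⊕ y · (s · a · f)
  minor-linear = solve-∀
  term : ∀ c → sign (toℕ c) · M zero c · det (minor M c) ≡
               x · (sign (toℕ c) · M₁ zero c · det (minor M₁ c)) ⊕
               y · (sign (toℕ c) · M₂ zero c · det (minor M₂ c))
  term c with c ≟ j
  ... | yes refl = begin
    s · M zero c · det (minor M c)
      ≡⟨ cong (λ e → s · e · det (minor M c)) (eq zero) ⟩
    s · (x · M₁ zero c ⊕ y · M₂ zero c) · det (minor M c)
      ≡⟨ entry-linear s x y (M₁ zero c) (M₂ zero c) (det (minor M c)) ⟩
    x · (s · M₁ zero c · det (minor M c)) ⊕ y · (s · M₂ zero c · det (minor M c))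
      ≡⟨ cong₂ (λ e f → x · (s · M₁ zero c · e) ⊕ y · (s · M₂ zero c · f))
               (det-cong (λ i k → eq₁ (suc i) (punchIn c k) (Fin.punchInᵢ≢i c k)))
               (det-cong (λ i k → eq₂ (suc i) (punchIn c k) (Fin.punchInᵢ≢i c k))) ⟩
    x · (s · M₁ zero c · det (minor M₁ c)) ⊕ y · (s · M₂ zero c · det (minor M₂ c)) ∎
    where s = sign (toℕ c)
  ... | no c≢j = begin
    s · M zero c · det (minor M c)
      ≡⟨ cong (s · M zero c ·_)
           (det-linear j′ x y (minor M c) (minor M₁ c) (minor M₂ c)
             (λ i k k≢ → eq₁ (suc i) (punchIn c k) (other k≢))
             (λ i k k≢ → eq₂ (suc i) (punchIn c k) (other k≢))
             (λ i → subst (λ t → M (suc i) t ≡ x · M₁ (suc i) t ⊕ y · M₂ (suc i) t)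
                          (sym j′↦j) (eq (suc i)))) ⟩
    s · M zero c · (x · det (minor M₁ c) ⊕ y · det (minor M₂ c))
      ≡⟨ minor-linear s x y (M zero c) (det (minor M₁ c)) (det (minor M₂ c)) ⟩
    x · (s · M zero c · det (minor M₁ c)) ⊕ y · (s · M zero c · det (minor M₂ c))
      ≡⟨ cong₂ (λ a b → x · (s · a · det (minor M₁ c)) ⊕ y · (s · b · det (minor M₂ c)))
               (eq₁ zero c c≢j) (eq₂ zero c c≢j) ⟩
    x · (s · M₁ zero c · det (minor M₁ c)) ⊕ y · (s · M₂ zero c · det (minor M₂ c)) ∎
    where
    s = sign (toℕ c)
    j′ = punchOut c≢j
    j′↦j : punchIn c j′ ≡ j
    j′↦j = Fin.punchIn-punchOut c≢j
    other : ∀ {k} → k ≢ j′ → punchIn c k ≢ j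
    other {k} k≢ eq = k≢ (Fin.punchIn-injective c k j′ (trans eq (sym j′↦j)))

-- Neighbouring columns, the second just after the first. The inductive form lets the deletion of a
-- column be followed by recursion.
data Adjacent : Fin n → Fin n → Set where
  here  : Adjacent {suc (suc n)} zero (suc zero)
  there : {a b : Fin n} → Adjacent a b → Adjacent (suc a) (suc b)

adjacent⇒≢ : {a b : Fin n} → Adjacent a b → a ≢ b
adjacent⇒≢ here      ()
adjacent⇒≢ (there p) refl = adjacent⇒≢ p refl

-- No third column lies between neighbours, so they stay neighbours in the minor; this feeds the
-- induction in `det-adjacent`.
adjacent-punchOut : {a b c : Fin (suc n)} → Adjacent a b → c ≢ a → c ≢ b →
                    ∃[ a′ ] ∃[ b′ ] Adjacent a′ b′ × punchIn c a′ ≡ a × punchIn c b′ ≡ b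
adjacent-punchOut {c = zero}              here c≢a c≢b = contradiction refl c≢a
adjacent-punchOut {c = suc zero}          here c≢a c≢b = contradiction refl c≢b
adjacent-punchOut {c = suc (suc {suc n} c)} here c≢a c≢b = zero , suc zero , here , refl , refl
adjacent-punchOut {c = zero} (there {a = a} {b} p) c≢a c≢b = a , b , p , refl , refl
adjacent-punchOut {n = suc n} {c = suc c} (there p) c≢a c≢b =
  let a′ , b′ , p′ , eqa , eqb = adjacent-punchOut p (c≢a ∘ cong suc) (c≢b ∘ cong suc)
  in suc a′ , suc b′ , there p′ , cong suc eqa , cong suc eqb

-- Deleting either of two equal neighbours leaves the same sequence, so the two corresponding minors
-- coincide.
adjacent-punchIn : {A : Set} {a b : Fin (suc n)} → Adjacent a b →
                   (f : Fin (suc n) → A) → f a ≡ f b →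
                   ∀ k → f (punchIn a k) ≡ f (punchIn b k)
adjacent-punchIn here      f eq zero    = sym eq
adjacent-punchIn here      f eq (suc k) = refl
adjacent-punchIn (there p) f eq zero    = refl
adjacent-punchIn {n = suc n} (there p) f eq (suc k) = adjacent-punchIn p (f ∘ suc) eq k

sign-suc : ∀ k → sign (suc k) ≡ - sign k
sign-suc zero          = refl
sign-suc (suc zero)    = refl
sign-suc (suc (suc k)) = sign-suc k

sign-adjacent : {a b : Fin n} → Adjacent a b → sign (toℕ b) ≡ - sign (toℕ a)
sign-adjacent here = refl
sign-adjacent (there {a = a} {b} p) =
  trans (sign-suc (toℕ b)) (cong -_ (trans (sign-adjacent p) (sym (sign-suc (toℕ a)))))

sum-adjacent : {a b : Fin n} → Adjacent a b → (f : Fin n → ℤ) →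
               (∀ c → c ≢ a → c ≢ b → f c ≡ 0ℤ) → f a ⊕ f b ≡ 0ℤ → sumℤ f ≡ 0ℤ
sum-adjacent here f others cancel =
  trans (sym (ℤ.+-assoc (f zero) (f (suc zero)) _))
        (cong₂ _⊕_ cancel (sum-zero (λ c → others (suc (suc c)) (λ ()) (λ ()))))
sum-adjacent (there p) f others cancel =
  cong₂ _⊕_ (others zero (λ ()) (λ ()))
    (sum-adjacent p (f ∘ suc)
      (λ c c≢a c≢b → others (suc c) (c≢a ∘ Fin.suc-injective) (c≢b ∘ Fin.suc-injective)) cancel)

-- In the expansion along the first row, a minor that keeps both columns vanishes by induction. The
-- two remaining terms have equal entries, equal minors and opposite signs.
det-adjacent : {a b : Fin n} → Adjacent a b → (M : Mat ℤ n n) → (∀ i → M i a ≡ M i b) → det M ≡ 0ℤ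
det-adjacent {suc n} {a} {b} p M eq = sum-adjacent p term others pair
  where
  term : Fin (suc n) → ℤ
  term c = sign (toℕ c) · M zero c · det (minor M c)
  others : ∀ c → c ≢ a → c ≢ b → term c ≡ 0ℤ
  others c c≢a c≢b =
    let a′ , b′ , p′ , eqa , eqb = adjacent-punchOut p c≢a c≢b
    in trans (cong (sign (toℕ c) · M zero c ·_)
               (det-adjacent p′ (minor M c) (λ i →
                 trans (cong (M (suc i)) eqa) (trans (eq (suc i)) (sym (cong (M (suc i)) eqb))))))
             (ℤ.*-zeroʳ (sign (toℕ c) · M zero c))
  opposite : ∀ s a e → s · a · e ⊕ - s · a · e ≡ 0ℤ
  opposite = solve-∀
  pair : term a ⊕ term b ≡ 0ℤ
  pair = begin
    term a ⊕ sign (toℕ b) · M zero b · det (minor M b)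
      ≡⟨ cong (term a ⊕_) (cong₂ _·_ (cong₂ _·_ (sign-adjacent p) (sym (eq zero)))
           (det-cong (λ i k → sym (adjacent-punchIn p (M (suc i)) (eq (suc i)) k)))) ⟩
    term a ⊕ - sign (toℕ a) · M zero a · det (minor M a)
      ≡⟨ opposite (sign (toℕ a)) (M zero a) (det (minor M a)) ⟩
    0ℤ ∎

replace : Mat ℤ m n → Fin n → (Fin m → ℤ) → Mat ℤ m n
replace M j u i k with k ≟ j
... | yes _ = u i
... | no  _ = M i k

replace-same : ∀ (M : Mat ℤ m n) j u i → replace M j u i j ≡ u i
replace-same M j u i with j ≟ j
... | yes _   = refl
... | no j≢j = contradiction refl j≢j

replace-other : ∀ (M : Mat ℤ m n) {j k} u i → k ≢ j → replace M j u i k ≡ M i k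
replace-other M {j} {k} u i k≢j with k ≟ j
... | yes k≡j = contradiction k≡j k≢j
... | no _    = refl

det-replace-linear : ∀ (M : Mat ℤ n n) j x y u v →
                     det (replace M j (λ i → x · u i ⊕ y · v i)) ≡
                     x · det (replace M j u) ⊕ y · det (replace M j v)
det-replace-linear M j x y u v = det-linear j x y _ _ _
  (λ i k k≢j → trans (replace-other M _ i k≢j) (sym (replace-other M u i k≢j)))
  (λ i k k≢j → trans (replace-other M _ i k≢j) (sym (replace-other M v i k≢j)))
  (λ i → trans (replace-same M j _ i)
               (sym (cong₂ (λ a b → x · a ⊕ y · b) (replace-same M j u i) (replace-same M j v i))))

-- The strict order of columns as a chain of neighbours, which is the recursion that `det-repeated`
-- follows.
data Before : Fin n → Fin n → Set where
  next : {a b : Fin n} → Adjacent a b → Before a b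
  step : {a b c : Fin n} → Adjacent a b → Before b c → Before a c

before-suc : {a b : Fin n} → Before a b → Before (suc a) (suc b)
before-suc (next p)   = next (there p)
before-suc (step p q) = step (there p) (before-suc q)

before-last : (j : Fin r) → Before (inject₁ j) (fromℕ r)
before-last {suc zero}    zero    = next here
before-last {suc (suc r)} zero    = step here (before-suc (before-last zero))
before-last {suc (suc r)} (suc j) = before-suc (before-last j)

before⇒< : {a b : Fin n} → Before a b → toℕ a < toℕ b
before⇒< (next p)   = adjacent⇒< p
  where
  adjacent⇒< : {a b : Fin n} → Adjacent a b → toℕ a < toℕ b
  adjacent⇒< here      = s≤s z≤n
  adjacent⇒< (there p) = s≤s (adjacent⇒< p)
before⇒< (step p q) = ℕ.<-trans (before⇒< (next p)) (before⇒< q)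

before⇒≢ : {a b : Fin n} → Before a b → a ≢ b
before⇒≢ p refl = ℕ.<-irrefl refl (before⇒< p)

-- Moving the first of the two equal columns towards the second: with y the repeated
-- column and x the column next to it, expanding D (y + x) (y + x) = 0 leaves only D y x.
det-repeated : {a b : Fin n} → Before a b → (M : Mat ℤ n n) → (∀ i → M i a ≡ M i b) → det M ≡ 0ℤ
det-repeated (next p) M eq = det-adjacent p M eq
det-repeated {n} {a} {c} (step {b = b} p q) M eq = begin
  det M
    ≡⟨ det-cong (λ i k → sym (D-self i k)) ⟩
  det (D y x)
    -- The three zeros inserted in the brackets stand for the determinants of `D y y`, `D x y` and
    -- `D x x`, in this order.
    ≡⟨ pad (det (D y x)) ⟩
  1ℤ · (1ℤ · 0ℤ ⊕ 1ℤ · det (D y x)) ⊕ 1ℤ · (1ℤ · 0ℤ ⊕ 1ℤ · 0ℤ)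
    ≡⟨ cong₂ (λ s t → 1ℤ · (1ℤ · s ⊕ 1ℤ · det (D y x)) ⊕ 1ℤ · t) (sym (D-diagonal y))
             (cong₂ (λ s t → 1ℤ · s ⊕ 1ℤ · t) (sym D-xy) (sym (D-diagonal x))) ⟩
  1ℤ · (1ℤ · det (D y y) ⊕ 1ℤ · det (D y x)) ⊕ 1ℤ · (1ℤ · det (D x y) ⊕ 1ℤ · det (D x x))
    ≡⟨ cong₂ (λ s t → 1ℤ · s ⊕ 1ℤ · t) (sym (det-replace-linear (replace M a y) b 1ℤ 1ℤ y x))
                                       (sym (det-replace-linear (replace M a x) b 1ℤ 1ℤ y x)) ⟩
  1ℤ · det (D y s) ⊕ 1ℤ · det (D x s)
    ≡⟨ D-linearˡ ⟨
  det (D s s)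
    ≡⟨ D-diagonal s ⟩
  0ℤ ∎
  where
  x y s : Fin n → ℤ
  x i = M i b
  y i = M i a
  s i = 1ℤ · y i ⊕ 1ℤ · x i

  D : (u v : Fin n → ℤ) → Mat ℤ n n
  D u v = replace (replace M a u) b v

  a≢b : a ≢ b
  a≢b = adjacent⇒≢ p

  pad : ∀ t → t ≡ 1ℤ · (1ℤ · 0ℤ ⊕ 1ℤ · t) ⊕ 1ℤ · (1ℤ · 0ℤ ⊕ 1ℤ · 0ℤ)
  pad = solve-∀

  D-a : ∀ u v i → D u v i a ≡ u i
  D-a u v i = trans (replace-other (replace M a u) v i a≢b) (replace-same M a u i)

  D-b : ∀ u v i → D u v i b ≡ v i
  D-b u v i = replace-same (replace M a u) b v i

  D-other : ∀ u v i {k} → k ≢ a → k ≢ b → D u v i k ≡ M i k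
  D-other u v i k≢a k≢b = trans (replace-other (replace M a u) v i k≢b) (replace-other M u i k≢a)

  D-self : ∀ i k → D y x i k ≡ M i k
  D-self i k = case k ≟ b of λ where
    (yes refl) → D-b y x i
    (no k≢b)   → case k ≟ a of λ where
      (yes refl) → D-a y x i
      (no k≢a)   → D-other y x i k≢a k≢b

  D-diagonal : ∀ u → det (D u u) ≡ 0ℤ
  D-diagonal u = det-adjacent p (D u u) (λ i → trans (D-a u u i) (sym (D-b u u i)))

  -- Here `y` has moved from `a` to `b`, one step closer to its copy at `c`, so the recursion runs
  -- on the shorter chain `q`.
  D-xy : det (D x y) ≡ 0ℤ
  D-xy = det-repeated q (D x y) (λ i → trans (D-b x y i) (trans (eq i)
    (sym (D-other x y i (before⇒≢ (step p q) ∘ sym) (before⇒≢ q ∘ sym)))))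

  D-linearˡ : det (D s s) ≡ 1ℤ · det (D y s) ⊕ 1ℤ · det (D x s)
  D-linearˡ = det-linear a 1ℤ 1ℤ (D s s) (D y s) (D x s) (agree y) (agree x)
    (λ i → trans (D-a s s i)
                 (sym (cong₂ (λ u v → 1ℤ · u ⊕ 1ℤ · v) (D-a y s i) (D-a x s i))))
    where
    agree : ∀ u i k → k ≢ a → D s s i k ≡ D u s i k
    agree u i k k≢a with k ≟ b
    ... | yes refl = refl
    ... | no _     = trans (replace-other M s i k≢a) (sym (replace-other M u i k≢a))

det-replace-comb : ∀ (M : Mat ℤ n n) j (c : Fin r → ℤ) (v : Fin r → Fin n → ℤ) →
                   (∀ k → det (replace M j (v k)) ≡ 0ℤ) → det (replace M j (comb c v)) ≡ 0ℤ
-- The empty combination is the zero column, read as `0ℤ · 0ℤ ⊕ 0ℤ · 0ℤ`.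
det-replace-comb {r = zero} M j c v eq = det-replace-linear M j 0ℤ 0ℤ (λ _ → 0ℤ) (λ _ → 0ℤ)
det-replace-comb {r = suc r} M j c v eq = begin
  det (replace M j (λ i → c zero · v zero i ⊕ comb (c ∘ suc) (v ∘ suc) i))
    ≡⟨ det-replace-cong (λ i →
         cong (c zero · v zero i ⊕_) (ℤ.*-identityˡ (comb (c ∘ suc) (v ∘ suc) i))) ⟨
  det (replace M j (λ i → c zero · v zero i ⊕ 1ℤ · comb (c ∘ suc) (v ∘ suc) i))
    ≡⟨ det-replace-linear M j (c zero) 1ℤ (v zero) (comb (c ∘ suc) (v ∘ suc)) ⟩
  c zero · det (replace M j (v zero)) ⊕ 1ℤ · det (replace M j (comb (c ∘ suc) (v ∘ suc)))
    ≡⟨ cong₂ (λ a b → c zero · a ⊕ 1ℤ · b) (eq zero)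
             (det-replace-comb M j (c ∘ suc) (v ∘ suc) (eq ∘ suc)) ⟩
  c zero · 0ℤ ⊕ 0ℤ
    ≡⟨ cong (_⊕ 0ℤ) (ℤ.*-zeroʳ (c zero)) ⟩
  0ℤ ∎
  where
  det-replace-cong : ∀ {u v} → (∀ i → u i ≡ v i) → det (replace M j u) ≡ det (replace M j v)
  det-replace-cong {u} {v} eq = det-cong agree
    where
    agree : ∀ i k → replace M j u i k ≡ replace M j v i k
    agree i k with k ≟ j
    ... | yes _ = eq i
    ... | no  _ = refl

-- A column operation: after scaling the last column by `d`, the multiples of earlier columns in it
-- contribute only determinants with a repeated column.
det-lastColumn : ∀ (M : Mat ℤ (suc r) (suc r)) d (c : Fin r → ℤ) b h →
                 (∀ i → d · M i (fromℕ r) ≡ b · h i ⊕ comb c (λ j → column M (inject₁ j)) i) →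
                 d · det M ≡ b · det (replace M (fromℕ r) h)
det-lastColumn {r} M d c b h eq = begin
  d · det M
    -- Scaling a column is treated as linearity with second coefficient `0ℤ`.
    ≡⟨ pad (d · det M) (det M) ⟩
  d · det M ⊕ 0ℤ · det M
    ≡⟨ det-linear last d 0ℤ N M M (λ i k → replace-other M u i) (λ i k → replace-other M u i)
         (λ i → trans (replace-same M last u i) (trans (sym (combination i))
                      (pad (d · M i last) (M i last)))) ⟨
  det N
    ≡⟨ det-replace-linear M last b 1ℤ h v ⟩
  b · det (replace M last h) ⊕ 1ℤ · det (replace M last v)
    ≡⟨ cong (λ t → b · det (replace M last h) ⊕ 1ℤ · t)
            (det-replace-comb M last c (λ j → column M (inject₁ j)) repeated) ⟩
  b · det (replace M last h) ⊕ 0ℤ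
    ≡⟨ ℤ.+-identityʳ _ ⟩
  b · det (replace M last h) ∎
  where
  last = fromℕ r
  v = comb c (λ j → column M (inject₁ j))
  u : Fin (suc r) → ℤ
  u i = b · h i ⊕ 1ℤ · v i
  N = replace M last u
  pad : ∀ a t → a ≡ a ⊕ 0ℤ · t
  pad = solve-∀
  combination : ∀ i → d · M i last ≡ u i
  combination i = trans (eq i) (cong (b · h i ⊕_) (sym (ℤ.*-identityˡ (v i))))
  repeated : ∀ j → det (replace M last (column M (inject₁ j))) ≡ 0ℤ
  repeated j = det-repeated (before-last j) (replace M last (column M (inject₁ j))) (λ i →
    trans (replace-other M _ i (before⇒≢ (before-last j))) (sym (replace-same M last _ i)))

-- The descent

apply : Mat ℤ m n → (Fin n → ℤ) → Fin m → ℤ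
apply A v i = A i ∙ v

apply-selfAdjoint : {A : Mat ℤ n n} → (∀ i j → A i j ≡ A j i) →
                    ∀ u v → u ∙ apply A v ≡ apply A u ∙ v
apply-selfAdjoint {A = A} symmetric u v = begin
  u ∙ apply A v
    ≡⟨ ∙-congʳ u (λ i → sum-cong (λ j →
         trans (cong (_· v j) (symmetric i j)) (ℤ.*-comm (A j i) (v j)))) ⟩
  u ∙ comb v A
    ≡⟨ ∙-comb u v A ⟩
  v ∙ (λ j → u ∙ A j)
    ≡⟨ ∙-congʳ v (λ j → ∙-comm u (A j)) ⟩
  v ∙ apply A u
    ≡⟨ ∙-comm v (apply A u) ⟩
  apply A u ∙ v ∎

∣-* : ∀ {a b x y} → a ∣ x → b ∣ y → a · b ∣ x · y
∣-* {a} {b} {x} {y} a∣x b∣y = ∣-trans (*-monoˡ-∣ b a∣x) (*-monoʳ-∣ x b∣y)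

-- The order is `suc (suc r)`, so `krylov (suc r)` consists of all columns of the walk matrix but
-- the last. The exponent `suc k` ensures that `π` divides `q`.
module Descent (p : ℕ) (pp : Prime p) (k : ℕ) {r : ℕ}
  (A : Mat ℤ (suc (suc r)) (suc (suc r))) (A-sym : ∀ i j → A i j ≡ A j i) where

  open AtPrime p pp
  open Krylov p pp A

  q : ℤ
  q = π^ (suc k)

  module _
    (indep : Indep (krylov (suc r)))
    (z : Fin (suc (suc r)) → ℤ) (i₀ : Fin (suc (suc r))) (π∤z₀ : ¬ (π ∣ z i₀))
    (q∣z∙w : ∀ m → q ∣ z ∙ w m)
    (qq∣z∙z : q · q ∣ z ∙ z)
    (qq∣z∙Az : q · q ∣ z ∙ apply A z)
    where

    q-cancelˡ : ∀ {a b} → ¬ (π ∣ a) → q ∣ a · b → q ∣ b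
    q-cancelˡ = π^-cancelˡ (suc k)

    π∣q : π ∣ q
    π∣q = subst (π ∣_) (sym (π^-suc k)) (∣m⇒∣m*n (π^ k) ∣-refl)

    q∣qq : q ∣ q · q
    q∣qq = ∣m⇒∣m*n q ∣-refl

    qq-cancelˡ : ∀ {a b} → ¬ (π ∣ a) → q · q ∣ a · b → q · q ∣ b
    qq-cancelˡ {a} {b} π∤a qq∣ab =
      subst (_∣ b) eq (π^-cancelˡ (suc k + suc k) π∤a (subst (_∣ a · b) (sym eq) qq∣ab))
      where
      eq : π^ (suc k + suc k) ≡ q · q
      eq = trans (cong +_ (ℕ.^-distribˡ-+-* p (suc k) (suc k))) (ℤ.pos-* (p ℕ.^ suc k) (p ℕ.^ suc k))

    z₀ : ℤ
    z₀ = z i₀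

    Az : Fin (suc (suc r)) → ℤ
    Az = apply A z

    e₀∙ : ∀ v → v ∙ δ i₀ ≡ v i₀
    e₀∙ v = sum-δ i₀ v

    basis : Fin (suc (suc r)) → Fin (suc (suc r)) → ℤ
    basis zero    = δ i₀
    basis (suc j) = w (toℕ j)

    -- Pairing a relation with `z` kills the walk vectors modulo `p` and leaves `c zero · z₀`, where
    -- `z₀` is prime to `p`; the rest is `indep`.
    basis-indep : Indep basis
    basis-indep c π∣c = λ where
        zero    → π∣c₀
        (suc j) → indep (c ∘ suc) (λ i → ∣m+n∣m⇒∣n (π∣c i) (∣m⇒∣m*n (δ i₀ i) π∣c₀)) j
      where
      tail∣ : π ∣ sumℤ (λ j → c (suc j) · (z ∙ w (toℕ j)))
      tail∣ = sum-∣ (λ j → ∣n⇒∣m*n (c (suc j)) (∣-trans π∣q (q∣z∙w (toℕ j))))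
      π∣c₀ : π ∣ c zero
      π∣c₀ = π-cancelˡ π∤z₀ (subst (π ∣_) (trans (cong (c zero ·_) (e₀∙ z)) (ℤ.*-comm (c zero) z₀))
        (∣m+n∣n⇒∣m (subst (π ∣_) (∙-comb z c basis) (sum-∣ (λ i → ∣n⇒∣m*n (z i) (π∣c i)))) tail∣))

    open DualBasis (dualBasis basis basis-indep)

    -- `d` times the coordinate functional of `δ i₀` with respect to `basis`.
    γ : Fin (suc (suc r)) → ℤ
    γ = y zero

    γ∙krylov : ∀ (j : Fin (suc r)) → γ ∙ w (toℕ j) ≡ 0ℤ
    γ∙krylov j = trans (∙-comm γ (w (toℕ j))) (trans (dual (suc j) zero) (ℤ.*-zeroʳ d))

    expand : ∀ v l → d · v l ≡ comb (λ j → y j ∙ v) basis l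
    expand = dual-expand {d = d} basis y complete

    -- In the expansion of `v` by the dual vectors `y j`, the coefficients are the products of `v`
    -- with `basis`. Modulo `q` only the one at `γ` survives, so `v` is proportional to `γ`.
    q∣residual : ∀ v → (∀ (j : Fin (suc r)) → q ∣ w (toℕ j) ∙ v) → ∀ l → q ∣ d · v l ⊕ - v i₀ · γ l
    q∣residual v q∣v l = subst (q ∣_) (sym (begin
      d · v l ⊕ - v i₀ · γ l
        ≡⟨ cong (_⊕ - v i₀ · γ l) (dual-expand {d = d} y basis complete′ v l) ⟩
      (δ i₀ ∙ v) · γ l ⊕ s ⊕ - v i₀ · γ l
        ≡⟨ cong (λ t → t · γ l ⊕ s ⊕ - v i₀ · γ l) (trans (∙-comm (δ i₀) v) (e₀∙ v)) ⟩
      v i₀ · γ l ⊕ s ⊕ - v i₀ · γ l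
        ≡⟨ cancel (v i₀) (γ l) s ⟩
      s ∎)) (sum-∣ (λ j → ∣m⇒∣m*n (y (suc j) l) (q∣v j)))
      where
      s = sumℤ (λ j → (w (toℕ j) ∙ v) · y (suc j) l)
      cancel : ∀ a b s → a · b ⊕ s ⊕ - a · b ≡ s
      cancel = solve-∀
      complete′ : ∀ i l → sumℤ (λ j → basis j i · y j l) ≡ d · δ i l
      complete′ i l = trans (sum-cong (λ j → ℤ.*-comm (basis j i) (y j l)))
                            (trans (complete l i) (cong (d ·_) (δ-sym l i)))

    ρ : Fin (suc (suc r)) → ℤ
    ρ l = d · z l ⊕ - z₀ · γ l

    q∣ρ : ∀ l → q ∣ ρ l
    q∣ρ = q∣residual z (λ j → subst (q ∣_) (∙-comm z (w (toℕ j))) (q∣z∙w (toℕ j)))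

    ν : ℤ
    ν = Az i₀

    B : (Fin (suc (suc r)) → ℤ) → Fin (suc (suc r)) → ℤ
    B v l = z₀ · apply A v l ⊕ - ν · v l

    B-selfAdjoint : ∀ u v → u ∙ B v ≡ B u ∙ v
    B-selfAdjoint u v = begin
      u ∙ B v
        ≡⟨ ∙-linearʳ z₀ (- ν) u (apply A v) v ⟩
      z₀ · (u ∙ apply A v) ⊕ - ν · (u ∙ v)
        ≡⟨ cong₂ (λ a b → z₀ · a ⊕ - ν · b)
             (trans (apply-selfAdjoint A-sym u v) (∙-comm (apply A u) v)) (∙-comm u v) ⟩
      z₀ · (v ∙ apply A u) ⊕ - ν · (v ∙ u)
        ≡⟨ ∙-linearʳ z₀ (- ν) v (apply A u) u ⟨
      v ∙ B u
        ≡⟨ ∙-comm v (B u) ⟩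
      B u ∙ v ∎

    -- Both `z` and `Az` are proportional to `γ` modulo `q`, with factors `z₀` and `ν`; the
    -- combination defining `B z` eliminates `γ`.
    q∣Bz : ∀ l → q ∣ B z l
    q∣Bz l = q-cancelˡ π∤d (subst (q ∣_) (regroup z₀ d (Az l) ν (γ l) (z l))
      (∣m∣n⇒∣m+n (∣n⇒∣m*n z₀ (q∣residual Az q∣Az l)) (∣n⇒∣m*n (- ν) (q∣ρ l))))
      where
      regroup : ∀ z₀ d a ν g z → z₀ · (d · a ⊕ - ν · g) ⊕ - ν · (d · z ⊕ - z₀ · g) ≡
                                 d · (z₀ · a ⊕ - ν · z)
      regroup = solve-∀
      -- By symmetry of `A`, pairing `Az` with a walk vector is pairing `z` with the next one.
      q∣Az : ∀ (j : Fin (suc r)) → q ∣ w (toℕ j) ∙ Az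
      q∣Az j = subst (q ∣_)
        (trans (∙-comm z (w (suc (toℕ j)))) (sym (apply-selfAdjoint A-sym (w (toℕ j)) z)))
                     (q∣z∙w (suc (toℕ j)))

    -- The definition of `ρ` solved for `z₀ · γ`; it transfers divisibility from products with `z`
    -- to products with `γ`.
    z₀γ∙ : ∀ v → z₀ · (γ ∙ v) ≡ d · (z ∙ v) ⊕ - (ρ ∙ v)
    z₀γ∙ v = begin
      z₀ · (γ ∙ v)
        ≡⟨ regroup z₀ d (γ ∙ v) (z ∙ v) ⟩
      d · (z ∙ v) ⊕ - (d · (z ∙ v) ⊕ - z₀ · (γ ∙ v))
        ≡⟨ cong (λ t → d · (z ∙ v) ⊕ - t) (begin
          d · (z ∙ v) ⊕ - z₀ · (γ ∙ v)
            ≡⟨ cong₂ (λ a b → d · a ⊕ - z₀ · b) (∙-comm z v) (∙-comm γ v) ⟩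
          d · (v ∙ z) ⊕ - z₀ · (v ∙ γ)
            ≡⟨ ∙-linearʳ d (- z₀) v z γ ⟨
          v ∙ ρ
            ≡⟨ ∙-comm v ρ ⟩
          ρ ∙ v ∎) ⟩
      d · (z ∙ v) ⊕ - (ρ ∙ v) ∎
      where
      regroup : ∀ z₀ d g x → z₀ · g ≡ d · x ⊕ - (d · x ⊕ - z₀ · g)
      regroup = solve-∀

    q∣γ∙z : q ∣ γ ∙ z
    q∣γ∙z = q-cancelˡ π∤z₀ (subst (q ∣_) (sym (z₀γ∙ z))
      (∣m∣n⇒∣m-n (∣n⇒∣m*n d (∣-trans q∣qq qq∣z∙z)) (sum-∣ (λ l → ∣m⇒∣m*n (z l) (q∣ρ l)))))

    -- Replacing `γ` by `z` costs only `ρ ∙ B z`, in which both factors are multiples of `q`. This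
    -- is where the second power of `q` is gained.
    qq∣γ∙Bz : q · q ∣ γ ∙ B z
    qq∣γ∙Bz = qq-cancelˡ π∤z₀ (subst (q · q ∣_) (sym (z₀γ∙ (B z)))
      (∣m∣n⇒∣m-n (∣n⇒∣m*n d qq∣z∙Bz) (sum-∣ (λ l → ∣-* (q∣ρ l) (q∣Bz l)))))
      where
      qq∣z∙Bz : q · q ∣ z ∙ B z
      qq∣z∙Bz = subst (q · q ∣_) (sym (∙-linearʳ z₀ (- ν) z Az z))
        (∣m∣n⇒∣m+n (∣n⇒∣m*n z₀ qq∣z∙Az) (∣n⇒∣m*n (- ν) qq∣z∙z))

    -- By linearity `z₀ · B γ` is `d · B z` minus `B ρ`, and both are multiples of `q`.
    q∣Bγ : ∀ l → q ∣ B γ l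
    q∣Bγ l = q-cancelˡ π∤z₀ (subst (q ∣_) (sym eq)
      (∣m∣n⇒∣m-n (∣n⇒∣m*n d (q∣Bz l))
                 (∣m∣n⇒∣m+n (∣n⇒∣m*n z₀ (sum-∣ (λ j → ∣n⇒∣m*n (A l j) (q∣ρ j))))
                            (∣n⇒∣m*n (- ν) (q∣ρ l)))))
      where
      regroup : ∀ z₀ d ν a b g x → z₀ · (z₀ · a ⊕ - ν · g) ≡
        d · (z₀ · b ⊕ - ν · x) ⊕ - (z₀ · (d · b ⊕ - z₀ · a) ⊕ - ν · (d · x ⊕ - z₀ · g))
      regroup = solve-∀
      eq : z₀ · B γ l ≡ d · B z l ⊕ - B ρ l
      eq = trans (regroup z₀ d ν (apply A γ l) (Az l) (γ l) (z l))
                 (cong (λ t → d · B z l ⊕ - (z₀ · t ⊕ - ν · ρ l)) (sym (∙-linearʳ d (- z₀) (A l) z γ)))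

    -- The coordinates of `d · z` at the walk vectors of `basis`.
    t : Fin (suc r) → ℤ
    t j = y (suc j) ∙ z

    -- The coordinate at `δ i₀` of `d` times the last column of the walk matrix.
    b : ℤ
    b = γ ∙ w (suc r)

    Bγ∙w : ∀ m → B γ ∙ w m ≡ z₀ · (γ ∙ w (suc m)) ⊕ - ν · (γ ∙ w m)
    Bγ∙w m = begin
      B γ ∙ w m
        ≡⟨ B-selfAdjoint γ (w m) ⟨
      γ ∙ B (w m)
        ≡⟨ ∙-linearʳ z₀ (- ν) γ (w (suc m)) (w m) ⟩
      z₀ · (γ ∙ w (suc m)) ⊕ - ν · (γ ∙ w m) ∎

    -- After moving `B` to `γ`, `z` is expanded along `basis`. Since `γ` kills `w 0` to `w r`, the
    -- product of `B γ` with `w j` vanishes for `j` below `r`, and only the top walk vector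
    -- contributes.
    dγ∙Bz : d · (γ ∙ B z) ≡ (γ ∙ z) · B γ i₀ ⊕ t (fromℕ r) · (z₀ · b)
    dγ∙Bz = begin
      d · (γ ∙ B z)
        ≡⟨ cong (d ·_) (B-selfAdjoint γ z) ⟩
      d · (B γ ∙ z)
        ≡⟨ sum-* d (λ l → B γ l · z l) ⟨
      sumℤ (λ l → d · (B γ l · z l))
        ≡⟨ sum-cong (λ l → trans (ℤ*.x∙yz≈y∙xz d (B γ l) (z l)) (cong (B γ l ·_) (expand z l))) ⟩
      B γ ∙ comb (λ j → y j ∙ z) basis
        ≡⟨ ∙-comb (B γ) (λ j → y j ∙ z) basis ⟩
      (γ ∙ z) · (B γ ∙ δ i₀) ⊕ sumℤ (λ j → t j · (B γ ∙ w (toℕ j)))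
        ≡⟨ cong₂ _⊕_ (cong ((γ ∙ z) ·_) (e₀∙ (B γ))) (sum-last (λ j → t j · (B γ ∙ w (toℕ j)))) ⟩
      (γ ∙ z) · B γ i₀ ⊕ (sumℤ (λ j → t (inject₁ j) · (B γ ∙ w (toℕ (inject₁ j))))
                            ⊕ t (fromℕ r) · (B γ ∙ w (toℕ (fromℕ r))))
        ≡⟨ cong ((γ ∙ z) · B γ i₀ ⊕_) (cong₂ _⊕_ (sum-zero lower) (cong (t (fromℕ r) ·_) top)) ⟩
      (γ ∙ z) · B γ i₀ ⊕ (0ℤ ⊕ t (fromℕ r) · (z₀ · b))
        ≡⟨ cong ((γ ∙ z) · B γ i₀ ⊕_) (ℤ.+-identityˡ _) ⟩
      (γ ∙ z) · B γ i₀ ⊕ t (fromℕ r) · (z₀ · b) ∎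
      where
      drop : ∀ z₀ b ν → z₀ · b ⊕ - ν · 0ℤ ≡ z₀ · b
      drop = solve-∀
      Bγ∙krylov : ∀ (j : Fin (suc r)) → B γ ∙ w (toℕ j) ≡ z₀ · (γ ∙ w (suc (toℕ j)))
      Bγ∙krylov j = trans (Bγ∙w (toℕ j))
        (trans (cong (λ s → z₀ · (γ ∙ w (suc (toℕ j))) ⊕ - ν · s) (γ∙krylov j))
               (drop z₀ (γ ∙ w (suc (toℕ j))) ν))
      lower : ∀ j → t (inject₁ j) · (B γ ∙ w (toℕ (inject₁ j))) ≡ 0ℤ
      lower j = trans (cong (t (inject₁ j) ·_) (trans (Bγ∙krylov (inject₁ j))
        (trans (cong (λ s → z₀ · (γ ∙ w (suc s))) (Fin.toℕ-inject₁ j))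
               (trans (cong (z₀ ·_) (γ∙krylov (suc j))) (ℤ.*-zeroʳ z₀)))))
        (ℤ.*-zeroʳ (t (inject₁ j)))
      top : B γ ∙ w (toℕ (fromℕ r)) ≡ z₀ · b
      top = trans (Bγ∙krylov (fromℕ r)) (cong (λ s → z₀ · (γ ∙ w (suc s))) (Fin.toℕ-fromℕ r))

    -- Comparing coefficients in `B z` modulo `p` gives a recursion from each `t j` to its
    -- predecessor. Divisibility of the top one would descend to all of them, and hence to `d · z₀`.
    π∤top : ¬ (π ∣ t (fromℕ r))
    π∤top π∣top = π∤* π∤d π∤z₀ (subst (π ∣_) (sym (expand z i₀)) (∣m∣n⇒∣m+n
      (∣m⇒∣m*n (δ i₀ i₀) π∣γ∙z) (sum-∣ (λ j → ∣m⇒∣m*n (w (toℕ j) i₀) (π∣t j)))))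
      where
      K = krylov (suc r)
      π∣γ∙z : π ∣ γ ∙ z
      π∣γ∙z = ∣-trans π∣q q∣γ∙z
      T : Fin (suc (suc r)) → ℤ
      T j = y j ∙ z
      -- Puts the expansions of `d · Az l` and `d · z l` into `d · B z l` and isolates the part
      -- spanned by `krylov (suc r)`.
      regroup : ∀ d z₀ az ν zl g a e s l x k →
        d · az ≡ g · a ⊕ (s ⊕ l · x) → d · zl ≡ g · e ⊕ k →
        z₀ · s ⊕ - ν · k ≡
        d · (z₀ · az ⊕ - ν · zl) ⊕ (- z₀ · (a · g) ⊕ - z₀ · (x · l)) ⊕ ν · (e · g)
      regroup d z₀ az ν zl g a e s l x k eq₁ eq₂ = begin
        z₀ · s ⊕ - ν · k
          ≡⟨ identity₁ z₀ ν g a e s l x k ⟩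
        (z₀ · (g · a ⊕ (s ⊕ l · x)) ⊕ - ν · (g · e ⊕ k)) ⊕ rest
          ≡⟨ cong₂ (λ u v → (z₀ · u ⊕ - ν · v) ⊕ rest)
                   (sym eq₁) (sym eq₂) ⟩
        (z₀ · (d · az) ⊕ - ν · (d · zl)) ⊕ rest
          ≡⟨ cong (_⊕ rest) (identity₂ d z₀ az ν zl) ⟩
        d · (z₀ · az ⊕ - ν · zl) ⊕ rest
          ≡⟨ ℤ.+-assoc (d · (z₀ · az ⊕ - ν · zl)) _ _ ⟨
        d · (z₀ · az ⊕ - ν · zl) ⊕ (- z₀ · (a · g) ⊕ - z₀ · (x · l)) ⊕ ν · (e · g) ∎
        where
        rest = (- z₀ · (a · g) ⊕ - z₀ · (x · l)) ⊕ ν · (e · g)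
        identity₁ : ∀ z₀ ν g a e s l x k → z₀ · s ⊕ - ν · k ≡
          (z₀ · (g · a ⊕ (s ⊕ l · x)) ⊕ - ν · (g · e ⊕ k))
            ⊕ ((- z₀ · (a · g) ⊕ - z₀ · (x · l)) ⊕ ν · (e · g))
        identity₁ = solve-∀
        identity₂ : ∀ d z₀ az ν zl → z₀ · (d · az) ⊕ - ν · (d · zl) ≡ d · (z₀ · az ⊕ - ν · zl)
        identity₂ = solve-∀
      dAz : ∀ l → d · Az l ≡ (γ ∙ z) · A l i₀ ⊕ (comb (shift t) K l ⊕ t (fromℕ r) · w (suc r) l)
      dAz l = begin
        d · Az l
          ≡⟨ sum-* d (λ j → A l j · z j) ⟨
        sumℤ (λ j → d · (A l j · z j))
          ≡⟨ sum-cong (λ j → trans (ℤ*.x∙yz≈y∙xz d (A l j) (z j)) (cong (A l j ·_) (expand z j))) ⟩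
        A l ∙ comb T basis
          ≡⟨ ∙-comb (A l) T basis ⟩
        (γ ∙ z) · (A l ∙ δ i₀) ⊕ comb t (λ j → w (suc (toℕ j))) l
          ≡⟨ cong₂ _⊕_ (cong ((γ ∙ z) ·_) (e₀∙ (A l))) (comb-shift t w l) ⟩
        (γ ∙ z) · A l i₀ ⊕ (comb (shift t) K l ⊕ t (fromℕ r) · w (suc r) l) ∎
      -- Modulo `p` the terms with `γ ∙ z` and with the top coordinate drop out, so independence of
      -- the walk vectors allows comparing coefficients.
      coefficients : ∀ j → π ∣ z₀ · shift t j ⊕ - ν · t j
      coefficients = indep (λ j → z₀ · shift t j ⊕ - ν · t j) λ l →
        subst (π ∣_)
          (sym (trans (comb-linear z₀ (- ν) (shift t) t K l)
            (regroup d z₀ (Az l) ν (z l) (γ ∙ z) (A l i₀) (δ i₀ l) (comb (shift t) K l) (t (fromℕ r))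
                     (w (suc r) l) (comb t K l) (dAz l) (expand z l))))
          (∣m∣n⇒∣m+n (∣m∣n⇒∣m+n (∣n⇒∣m*n d (∣-trans π∣q (q∣Bz l)))
            (∣m∣n⇒∣m+n (∣n⇒∣m*n (- z₀) (∣n⇒∣m*n (A l i₀) π∣γ∙z))
                       (∣n⇒∣m*n (- z₀) (∣n⇒∣m*n (w (suc r) l) π∣top))))
            (∣n⇒∣m*n ν (∣n⇒∣m*n (δ i₀ l) π∣γ∙z)))
      π∣t : ∀ j → π ∣ t j
      -- Downward induction: `shift t (suc j)` is `t (inject₁ j)`, the coordinate preceding
      -- `t (suc j)`.
      π∣t = >-weakInduction (λ j → π ∣ t j) π∣top λ j π∣next →
        π-cancelˡ π∤z₀ (∣m+n∣n⇒∣m (coefficients (suc j)) (∣n⇒∣m*n (- ν) π∣next))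

    -- In `dγ∙Bz` the left side and the product of `γ ∙ z` with `B γ i₀` are multiples of `q · q`;
    -- the factors `t (fromℕ r)` and `z₀` of the last term are prime to `p`.
    qq∣b : q · q ∣ b
    qq∣b = qq-cancelˡ (π∤* π∤top π∤z₀) (subst (q · q ∣_) (sym (ℤ.*-assoc (t (fromℕ r)) z₀ b))
      (∣m+n∣m⇒∣n (subst (q · q ∣_) dγ∙Bz (∣n⇒∣m*n d qq∣γ∙Bz)) (∣-* q∣γ∙z (q∣Bγ i₀))))

    walks : Mat ℤ (suc (suc r)) (suc (suc r))
    walks i j = w (toℕ j) i

    -- Up to multiples of the earlier columns, `d` times the last column is `b · δ i₀`.
    qq∣det : q · q ∣ det walks
    qq∣det = qq-cancelˡ π∤d (subst (q · q ∣_)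
      (sym (det-lastColumn walks d (λ j → y (suc j) ∙ w (suc r)) b (δ i₀) lastColumn))
      (∣m⇒∣m*n (det (replace walks (fromℕ (suc r)) (δ i₀))) qq∣b))
      where
      lastColumn : ∀ i → d · walks i (fromℕ (suc r)) ≡
                   b · δ i₀ i ⊕ comb (λ j → y (suc j) ∙ w (suc r)) (λ j → column walks (inject₁ j)) i
      lastColumn i = begin
        d · w (toℕ (fromℕ (suc r))) i
          ≡⟨ cong (λ s → d · w s i) (Fin.toℕ-fromℕ (suc r)) ⟩
        d · w (suc r) i
          ≡⟨ expand (w (suc r)) i ⟩
        b · δ i₀ i ⊕ sumℤ (λ j → (y (suc j) ∙ w (suc r)) · w (toℕ j) i)
          ≡⟨ cong (b · δ i₀ i ⊕_) (sum-cong (λ j →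
               cong (λ s → (y (suc j) ∙ w (suc r)) · w s i) (sym (Fin.toℕ-inject₁ j)))) ⟩
        b · δ i₀ i ⊕ comb (λ j → y (suc j) ∙ w (suc r)) (λ j → column walks (inject₁ j)) i ∎

-- From rational to integral matrices

toℚᵘ-ℤ→ℚ : ∀ a → toℚᵘ (ℤ→ℚ a) ℚᵘ.≃ mkℚᵘ a 0
toℚᵘ-ℤ→ℚ a = ℚ.toℚᵘ-fromℚᵘ (mkℚᵘ a 0)

ℤ→ℚ-injective : ∀ {a b} → ℤ→ℚ a ≡ ℤ→ℚ b → a ≡ b
ℤ→ℚ-injective {a} {b} eq with ℚ.fromℚᵘ-injective {mkℚᵘ a 0} {mkℚᵘ b 0} eq
... | *≡* a·1≡b·1 = trans (sym (ℤ.*-identityʳ a)) (trans a·1≡b·1 (ℤ.*-identityʳ b))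

ℤ→ℚ-+ : ∀ a b → ℤ→ℚ (a ⊕ b) ≡ ℤ→ℚ a ℚ.+ ℤ→ℚ b
ℤ→ℚ-+ a b = ℚ.toℚᵘ-injective
  (ℚᵘ.≃-trans (toℚᵘ-ℤ→ℚ (a ⊕ b))
  (ℚᵘ.≃-trans (*≡* (cong (_· 1ℤ) (cong₂ _⊕_ (sym (ℤ.*-identityʳ a)) (sym (ℤ.*-identityʳ b)))))
  (ℚᵘ.≃-trans (ℚᵘ.+-cong (ℚᵘ.≃-sym (toℚᵘ-ℤ→ℚ a)) (ℚᵘ.≃-sym (toℚᵘ-ℤ→ℚ b)))
              (ℚᵘ.≃-sym (ℚ.toℚᵘ-homo-+ (ℤ→ℚ a) (ℤ→ℚ b))))))

ℤ→ℚ-* : ∀ a b → ℤ→ℚ (a · b) ≡ ℤ→ℚ a ℚ.* ℤ→ℚ b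
ℤ→ℚ-* a b = ℚ.toℚᵘ-injective
  (ℚᵘ.≃-trans (toℚᵘ-ℤ→ℚ (a · b))
  (ℚᵘ.≃-trans (ℚᵘ.*-cong (ℚᵘ.≃-sym (toℚᵘ-ℤ→ℚ a)) (ℚᵘ.≃-sym (toℚᵘ-ℤ→ℚ b)))
              (ℚᵘ.≃-sym (ℚ.toℚᵘ-homo-* (ℤ→ℚ a) (ℤ→ℚ b)))))

ℤ→ℚ-sum : ∀ x {f : Fin n → ℤ} {a : Fin n → ℚ} → (∀ i → ℤ→ℚ (f i) ≡ x ℚ.* a i) →
          ℤ→ℚ (sumℤ f) ≡ x ℚ.* sumℚ a
ℤ→ℚ-sum {zero}  x eq = sym (ℚ.*-zeroʳ x)
ℤ→ℚ-sum {suc n} x {f} {a} eq = begin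
  ℤ→ℚ (f zero ⊕ sumℤ (f ∘ suc))             ≡⟨ ℤ→ℚ-+ (f zero) (sumℤ (f ∘ suc)) ⟩
  ℤ→ℚ (f zero) ℚ.+ ℤ→ℚ (sumℤ (f ∘ suc))     ≡⟨ cong₂ ℚ._+_ (eq zero) (ℤ→ℚ-sum x (eq ∘ suc)) ⟩
  x ℚ.* a zero ℚ.+ x ℚ.* sumℚ (a ∘ suc)     ≡⟨ ℚ.*-distribˡ-+ x (a zero) (sumℚ (a ∘ suc)) ⟨
  x ℚ.* (a zero ℚ.+ sumℚ (a ∘ suc))         ∎

ℤ→ℚ-∙ : ∀ x y (u v : Fin n → ℤ) {a b : Fin n → ℚ} →
        (∀ i → ℤ→ℚ (u i) ≡ x ℚ.* a i) → (∀ i → ℤ→ℚ (v i) ≡ y ℚ.* b i) →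
        ℤ→ℚ (u ∙ v) ≡ x ℚ.* y ℚ.* sumℚ (λ i → a i ℚ.* b i)
ℤ→ℚ-∙ x y u v {a} {b} equ eqv = ℤ→ℚ-sum (x ℚ.* y) λ i →
  trans (ℤ→ℚ-* (u i) (v i)) (trans (cong₂ ℚ._*_ (equ i) (eqv i)) (ℚ*.interchange x (a i) y (b i)))

ℤ→ℚ-δ : ∀ (i j : Fin n) → ℤ→ℚ (δ i j) ≡ identity i j
ℤ→ℚ-δ i j with i ≟ j
... | yes refl = cong ℤ→ℚ (δ-refl i)
... | no i≢j   = cong ℤ→ℚ (δ-≢ i≢j)

-- Z is the integral matrix ℓ Q.
record ScaledOrthogonal {n} (A : Mat ℤ n n) (ℓ : ℤ) (Z : Mat ℤ n n) : Set where
  field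
    rows        : ∀ i → sumℤ (Z i) ≡ ℓ
    columns     : ∀ i j → column Z i ∙ column Z j ≡ ℓ · ℓ · δ i j
    conjugation : ∀ i j → ∃[ b ] column Z i ∙ apply A (column Z j) ≡ ℓ · ℓ · b

scaledOrthogonal : ∀ (G : SimpleGraph n) Q → InQ G Q → ∀ ℓ (Z : Mat ℤ n n) →
                   (∀ i j → ℤ→ℚ (Z i j) ≡ ℤ→ℚ ℓ ℚ.* Q i j) →
                   ScaledOrthogonal (adjacency G) ℓ Z
scaledOrthogonal {n} G Q ((orthogonal , regular) , zeroOne) ℓ Z eq = record
  { rows = λ i → ℤ→ℚ-injective
      (trans (ℤ→ℚ-sum (ℤ→ℚ ℓ) (eq i))
             (trans (cong (ℤ→ℚ ℓ ℚ.*_) (regular i)) (ℚ.*-identityʳ (ℤ→ℚ ℓ))))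
  ; columns = λ i j → ℤ→ℚ-injective
      (trans (ℤ→ℚ-∙ (ℤ→ℚ ℓ) (ℤ→ℚ ℓ) (column Z i) (column Z j) (λ k → eq k i) (λ k → eq k j))
             (scaled (δ i j) (trans (orthogonal i j) (sym (ℤ→ℚ-δ i j)))))
  ; conjugation = λ i j → bit i j , ℤ→ℚ-injective
      (trans (ℤ→ℚ-∙ (ℤ→ℚ ℓ) (ℤ→ℚ ℓ) (column Z i) (apply A (column Z j))
               (λ k → eq k i) (λ k → eqA k j))
             (scaled (bit i j) (isBit i j)))
  }
  where
  A = adjacency G
  Aℚ : Mat ℚ n n
  Aℚ i j = ℤ→ℚ (A i j)

  eqA : ∀ i j → ℤ→ℚ (apply A (column Z j) i) ≡ ℤ→ℚ ℓ ℚ.* (Aℚ ⊗ Q) i j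
  eqA i j = ℤ→ℚ-sum (ℤ→ℚ ℓ) λ k →
    trans (ℤ→ℚ-* (A i k) (Z k j))
          (trans (cong (Aℚ i k ℚ.*_) (eq k j)) (ℚ*.x∙yz≈y∙xz (Aℚ i k) (ℤ→ℚ ℓ) (Q k j)))

  scaled : ∀ b {x} → x ≡ ℤ→ℚ b → ℤ→ℚ ℓ ℚ.* ℤ→ℚ ℓ ℚ.* x ≡ ℤ→ℚ (ℓ · ℓ · b)
  scaled b refl = sym (trans (ℤ→ℚ-* (ℓ · ℓ) b) (cong (ℚ._* ℤ→ℚ b) (ℤ→ℚ-* ℓ ℓ)))

  bits : ∀ i j → ∃[ b ] (transpose Q ⊗ (Aℚ ⊗ Q)) i j ≡ ℤ→ℚ b
  bits i j = [ (0ℤ ,_) , (1ℤ ,_) ]′ (zeroOne i j)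

  bit : Fin n → Fin n → ℤ
  bit i j = proj₁ (bits i j)

  isBit : ∀ i j → (transpose Q ⊗ (Aℚ ⊗ Q)) i j ≡ ℤ→ℚ (bit i j)
  isBit i j = proj₂ (bits i j)

-- Columns of the scaled matrix against walk vectors.

module _ {n} {A : Mat ℤ n n} (A-sym : ∀ i j → A i j ≡ A j i)
         {ℓ : ℤ} (ℓ≢0 : ℓ ≢ 0ℤ) {Z : Mat ℤ n n} (scaledOrth : ScaledOrthogonal A ℓ Z) where
  open ScaledOrthogonal scaledOrth

  private
    instance
      ℓ-nonZero : ℤ.NonZero ℓ
      ℓ-nonZero = ℤ.≢-nonZero ℓ≢0

    ℓℓ≢0 : ℓ · ℓ ≢ 0ℤ
    ℓℓ≢0 eq = [ ℓ≢0 , ℓ≢0 ]′ (ℤ.i*j≡0⇒i≡0∨j≡0 ℓ eq)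

    z : Fin n → Fin n → ℤ
    z = column Z

    complete : ∀ k l → sumℤ (λ j → z j k · z j l) ≡ ℓ · ℓ · δ k l
    complete = dual-complete ℓℓ≢0 z z columns

  -- The row sums say that `Z` maps the all-ones vector to `ℓ` times itself. Applying the transpose
  -- of `Z`, whose product with `Z` is `ℓ · ℓ` times the identity, and cancelling `ℓ` gives the
  -- column sums.
  column-sum : ∀ c → z c ∙ walkVec A 0 ≡ ℓ
  column-sum c = ℤ.*-cancelˡ-≡ ℓ _ _ (begin
    ℓ · (z c ∙ (λ _ → 1ℤ))
      ≡⟨ sum-* ℓ (λ i → z c i · 1ℤ) ⟨
    sumℤ (λ i → ℓ · (z c i · 1ℤ))
      ≡⟨ sum-cong (λ i → trans (regroup ℓ (z c i))
           (cong (z c i ·_) (trans (sym (rows i)) (sum-cong (λ j → sym (ℤ.*-identityˡ (Z i j))))))) ⟩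
    z c ∙ comb (λ _ → 1ℤ) z
      ≡⟨ ∙-comb (z c) (λ _ → 1ℤ) z ⟩
    sumℤ (λ j → 1ℤ · (z c ∙ z j))
      ≡⟨ sum-cong (λ j → trans (ℤ.*-identityˡ (z c ∙ z j)) (columns c j)) ⟩
    sumℤ (λ j → ℓ · ℓ · δ c j)
      ≡⟨ sum-δ c (λ _ → ℓ · ℓ) ⟩
    ℓ · ℓ ∎)
    where
    regroup : ∀ l a → l · (a · 1ℤ) ≡ a · l
    regroup = solve-∀

  -- Induction on `m`: the transpose of `Z` intertwines `A` with the integral matrix `B` of
  -- conjugation coefficients. Products with the next walk vector are thus integral combinations of
  -- those with the current one.
  ∣column∙walk : ∀ c m → ℓ ∣ z c ∙ walkVec A m
  ∣column∙walk c zero    = divides 1ℤ (trans (column-sum c) (sym (ℤ.*-identityˡ ℓ)))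
  ∣column∙walk c (suc m) = subst (ℓ ∣_)
    (ℤ.*-cancelˡ-≡ (ℓ · ℓ) _ _ {{ℤ.≢-nonZero ℓℓ≢0}} (sym expansion))
    (sum-∣ (λ j → ∣m⇒∣m*n (B c j) (∣column∙walk j m)))
    where
    w = walkVec A m
    B : Fin n → Fin n → ℤ
    B i j = proj₁ (conjugation i j)
    s : Fin n → ℤ
    s j = z j ∙ w
    expansion : ℓ · ℓ · (z c ∙ apply A w) ≡ ℓ · ℓ · sumℤ (λ j → s j · B c j)
    expansion = begin
      ℓ · ℓ · (z c ∙ apply A w)
        ≡⟨ cong (ℓ · ℓ ·_) (apply-selfAdjoint A-sym (z c) w) ⟩
      ℓ · ℓ · (apply A (z c) ∙ w)
        ≡⟨ sum-* (ℓ · ℓ) (λ i → apply A (z c) i · w i) ⟨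
      sumℤ (λ i → ℓ · ℓ · (apply A (z c) i · w i))
        ≡⟨ sum-cong (λ i → trans (ℤ*.x∙yz≈y∙xz (ℓ · ℓ) (apply A (z c) i) (w i))
             (cong (apply A (z c) i ·_) (dual-expand {d = ℓ · ℓ} z z complete w i))) ⟩
      apply A (z c) ∙ comb s z
        ≡⟨ ∙-comb (apply A (z c)) s z ⟩
      sumℤ (λ j → s j · (apply A (z c) ∙ z j))
        ≡⟨ sum-cong (λ j → trans
             (cong (s j ·_) (trans (sym (apply-selfAdjoint A-sym (z c) (z j))) (proj₂ (conjugation c j))))
             (ℤ*.x∙yz≈y∙xz (s j) (ℓ · ℓ) (B c j))) ⟩
      sumℤ (λ j → ℓ · ℓ · (s j · B c j))
        ≡⟨ sum-* (ℓ · ℓ) (λ j → s j · B c j) ⟩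
      ℓ · ℓ · sumℤ (λ j → s j · B c j) ∎

-- Prime powers in the level, the least common multiple and the determinant.

adjacency-sym : ∀ (G : SimpleGraph n) i j → adjacency G i j ≡ adjacency G j i
adjacency-sym G i j = cong bool→ℤ (adj-sym G i j)

^-monoʳ-∣ : ∀ p {m n} → m ≤ n → p ℕ.^ m ℕD.∣ p ℕ.^ n
^-monoʳ-∣ p {m} {n} m≤n = ℕD.divides (p ℕ.^ (n ℕ.∸ m))
  (trans (cong (p ℕ.^_) (sym (ℕ.m∸n+n≡m m≤n))) (ℕ.^-distribˡ-+-* p (n ℕ.∸ m) m))

module _ (p : ℕ) (pp : Prime p) where
  open AtPrime p pp

  indepMod⇒indep : (v : Fin r → Fin m → ℤ) → LinIndepMod p v → Indep v
  indepMod⇒indep v indep c π∣c j = ∣ᵤ⇒∣ (indep c (λ i → ∣⇒∣ᵤ (π∣c i)) j)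

  -- If `π` divided every entry of `Z`, the smaller multiplier `ℓ′`, which is `ℓ` divided by `p`,
  -- would already make `Q` integral.
  level-primitive : ∀ (Q : Mat ℚ m n) ℓ → IsLevel Q ℓ → p ℕD.∣ ℓ →
                    (Z : Mat ℤ m n) → (∀ i j → ℤ→ℚ (Z i j) ≡ ℤ→ℚ (+ ℓ) ℚ.* Q i j) →
                    ∃[ i ] ∃[ j ] ¬ (π ∣ Z i j)
  level-primitive Q ℓ (0<ℓ , _ , minimal) (ℕD.divides ℓ′ refl) Z eq
    with Fin.all? (λ i → Fin.all? (λ j → π ∣? Z i j))
  ... | no ¬all =
    let i , ¬row = Fin.¬∀⟶∃¬ _ _ (λ i → Fin.all? (λ j → π ∣? Z i j)) ¬all
        j , π∤Z = Fin.¬∀⟶∃¬ _ _ (λ j → π ∣? Z i j) ¬row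
    in i , j , π∤Z
  ... | yes all = contradiction
    (λ i j → quotient (all i j) , *-cancelʳ-π (begin
      ℤ→ℚ (+ ℓ′) ℚ.* Q i j ℚ.* ℤ→ℚ π
        ≡⟨ ℚ*.xy∙z≈xz∙y (ℤ→ℚ (+ ℓ′)) (Q i j) (ℤ→ℚ π) ⟩
      ℤ→ℚ (+ ℓ′) ℚ.* ℤ→ℚ π ℚ.* Q i j
        ≡⟨ cong (ℚ._* Q i j) (ℤ→ℚ-* (+ ℓ′) π) ⟨
      ℤ→ℚ (+ ℓ′ · π) ℚ.* Q i j
        ≡⟨ cong (λ x → ℤ→ℚ x ℚ.* Q i j) (ℤ.pos-* ℓ′ p) ⟨
      ℤ→ℚ (+ (ℓ′ * p)) ℚ.* Q i j
        ≡⟨ eq i j ⟨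
      ℤ→ℚ (Z i j)
        ≡⟨ cong ℤ→ℚ (_∣_.equality (all i j)) ⟩
      ℤ→ℚ (quotient (all i j) · π)
        ≡⟨ ℤ→ℚ-* (quotient (all i j)) π ⟩
      ℤ→ℚ (quotient (all i j)) ℚ.* ℤ→ℚ π ∎))
    (minimal ℓ′ (ℕ.n≢0⇒n>0 ℓ′≢0)
      (ℕ.m<m*n ℓ′ p {{ℕ.≢-nonZero ℓ′≢0}} (ℕ.nonTrivial⇒n>1 p {{prime⇒nonTrivial pp}})))
    where
    ℓ′≢0 : ℓ′ ≢ 0
    ℓ′≢0 refl = ℕ.<-irrefl refl 0<ℓ
    *-cancelʳ-π : ∀ {a b} → a ℚ.* ℤ→ℚ π ≡ b ℚ.* ℤ→ℚ π → a ≡ b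
    *-cancelʳ-π eq = ℚ.≤-antisym
      (ℚ.*-cancelʳ-≤-pos (ℤ→ℚ π) (ℚ.≤-reflexive eq))
      (ℚ.*-cancelʳ-≤-pos (ℤ→ℚ π) (ℚ.≤-reflexive (sym eq)))
      where
      instance
        ℤ→ℚ-π-positive : ℚ.Positive (ℤ→ℚ π)
        ℤ→ℚ-π-positive = ℚ.normalize-pos p 1 {{_}} {{ℕ.≢-nonZero p≢0}}

  level-bound : ∀ (G : SimpleGraph (suc r)) → RankMod p (walkMatrix G) r →
                ∀ k Q ℓ → InQ G Q → IsLevel Q ℓ → p ℕ.^ suc k ℕD.∣ ℓ →
                π^ (suc k) · π^ (suc k) ∣ det (walkMatrix G)
  level-bound {r} G rank k Q ℓ inQ level@(0<ℓ , integral , _) p^∣ℓ = go G rank Z scaledOrth unitEntry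
    where
    q = π^ (suc k)

    q∣ℓ : q ∣ + ℓ
    q∣ℓ = ∣ᵤ⇒∣ p^∣ℓ

    ℓ≢0 : + ℓ ≢ 0ℤ
    ℓ≢0 eq = ℕ.<-irrefl (sym (ℤ.+-injective eq)) 0<ℓ

    Z : Mat ℤ (suc r) (suc r)
    Z i j = proj₁ (integral i j)

    scaledOrth : ScaledOrthogonal (adjacency G) (+ ℓ) Z
    scaledOrth = scaledOrthogonal G Q inQ (+ ℓ) Z (λ i j → sym (proj₂ (integral i j)))

    unitEntry : ∃[ i ] ∃[ j ] ¬ (π ∣ Z i j)
    unitEntry = level-primitive Q ℓ level (ℕD.∣-trans (ℕD.m∣m*n (p ℕ.^ k)) p^∣ℓ) Z
                  (λ i j → sym (proj₂ (integral i j)))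

    go : ∀ {r} (G : SimpleGraph (suc r)) → RankMod p (walkMatrix G) r →
         (Z : Mat ℤ (suc r) (suc r)) → ScaledOrthogonal (adjacency G) (+ ℓ) Z →
         (∃[ i ] ∃[ j ] ¬ (π ∣ Z i j)) → q · q ∣ det (walkMatrix G)
    -- On a single vertex the row sum forces the only entry of `Z` to be `ℓ`, which `p` divides.
    go {zero} G _ Z scaledOrth (zero , zero , π∤Z) =
      contradiction (∣-trans π∣q (subst (q ∣_) (sym Z≡ℓ) q∣ℓ)) π∤Z
      where
      π∣q : π ∣ q
      π∣q = subst (π ∣_) (sym (π^-suc k)) (∣m⇒∣m*n (π^ k) ∣-refl)
      Z≡ℓ : Z zero zero ≡ + ℓ
      Z≡ℓ = trans (sym (ℤ.+-identityʳ (Z zero zero))) (ScaledOrthogonal.rows scaledOrth zero)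
    go {suc r} G ((f , _ , f-indep) , _) Z scaledOrth (i₀ , c , π∤Z) =
      Descent.qq∣det p pp k (adjacency G) (adjacency-sym G)
        -- The rank hypothesis selects some independent columns; `krylov-indep` passes from them to
        -- the leading ones.
        (krylov-indep (toℕ ∘ f) (indepMod⇒indep (λ j → w (toℕ (f j))) f-indep)
                      (suc r) ℕ.≤-refl)
        (column Z c) i₀ π∤Z
        (λ m → ∣-trans q∣ℓ (∣column∙walk (adjacency-sym G) ℓ≢0 scaledOrth c m))
        (subst (q · q ∣_) (sym (columns c c)) (∣m⇒∣m*n (δ c c) (∣-* q∣ℓ q∣ℓ)))
        (subst (q · q ∣_) (sym (proj₂ (conjugation c c))) (∣m⇒∣m*n _ (∣-* q∣ℓ q∣ℓ)))
      where
      open Krylov p pp (adjacency G)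
      open ScaledOrthogonal scaledOrth

  -- Otherwise every element of S would already divide L / p.
  lcm-valuation : ∀ {S : ℕ → Set} {L} → IsLCM S L → ∀ k → Valuation p (+ L) (suc k) →
                  ¬ (∀ ℓ → S ℓ → ¬ (p ℕ.^ suc k ℕD.∣ ℓ))
  lcm-valuation {S} {L} (multiple , least) k (ℕD.divides x refl , ¬p^∣L) p^∤ =
    ℕD.>⇒∤ {{ℕ.≢-nonZero M≢0}} M<pM (subst (ℕD._∣ M) L≡Mp (least M M-multiple))
    where
    M = x * p ℕ.^ k

    L≡Mp : x * p ℕ.^ suc k ≡ M * p
    L≡Mp = trans (cong (x *_) (ℕ.*-comm p (p ℕ.^ k))) (sym (ℕ.*-assoc x (p ℕ.^ k) p))

    -- Every power of `p` divides `0`, so a valuation rules out `L` being `0`.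
    M≢0 : M ≢ 0
    M≢0 M≡0 = ¬p^∣L
      (subst (p ℕ.^ suc (suc k) ℕD.∣_) (sym (trans L≡Mp (cong (_* p) M≡0))) (_ ℕD.∣0))

    M<pM : M < M * p
    M<pM = ℕ.m<m*n M p {{ℕ.≢-nonZero M≢0}} (ℕ.nonTrivial⇒n>1 p {{prime⇒nonTrivial pp}})

    M-multiple : ∀ ℓ → S ℓ → ℓ ℕD.∣ M
    M-multiple ℓ ℓ∈S with multiple ℓ ℓ∈S
    ... | ℕD.divides c L≡cℓ with p ℕD.∣? c
    -- A factor `p` in the cofactor `c` can be cancelled from `L`. If `c` is prime to `p`, the whole
    -- power `p ℕ.^ suc k` must lie in `ℓ`, which `p^∤` excludes.
    ... | yes (ℕD.divides c′ refl) = ℕD.divides c′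
      (ℕ.*-cancelʳ-≡ M (c′ * ℓ) p {{ℕ.≢-nonZero p≢0}}
        (trans (sym L≡Mp) (trans L≡cℓ (ℕ*.xy∙z≈xz∙y c′ p ℓ))))
    ... | no p∤c = contradiction
      (∣⇒∣ᵤ (π^-cancelˡ (suc k) {+ c} {+ ℓ} (p∤c ∘ ∣⇒∣ᵤ)
        (subst (π^ (suc k) ∣_) (ℤ.pos-* c ℓ) (∣ᵤ⇒∣ (ℕD.divides x (sym L≡cℓ))))))
      (p^∤ ℓ ℓ∈S)

  valuation-bound : ∀ {x t} k → Valuation p x t → π^ (suc k) · π^ (suc k) ∣ x → 2 * suc k ≤ t
  valuation-bound {x} {t} k (_ , ¬p^∣x) qq∣x = ℕ.≮⇒≥ λ t<2k →
    ¬p^∣x (ℕD.∣-trans (^-monoʳ-∣ p t<2k) (subst (ℕD._∣ abs x) eq (∣⇒∣ᵤ qq∣x)))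
    where
    q = p ℕ.^ suc k
    eq : abs (+ q · + q) ≡ p ℕ.^ (2 * suc k)
    eq = trans (ℤ.abs-* (+ q) (+ q)) (trans (sym (ℕ.^-distribˡ-+-* p (suc k) (suc k)))
           (cong (λ m → p ℕ.^ (suc k + m)) (sym (ℕ.+-identityʳ (suc k)))))

theorem1p5 : (n : ℕ) (G : SimpleGraph n) → controllable G →
    (p : ℕ) → Prime p → ¬ (p ≡ 2) →
    (r : ℕ) → suc r ≡ n → RankMod p (walkMatrix G) r →
    (L : ℕ) → IsLG G L →
    (s t : ℕ) → Valuation p (+ L) s → Valuation p (det (walkMatrix G)) t →
    2 * s ≤ t
theorem1p5 n G _ p pp _ r refl rank L lcm zero t _ _ = z≤n
theorem1p5 n G _ p pp _ r refl rank L lcm (suc k) t vL vdet with 2 * suc k ℕ.≤? t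
... | yes 2s≤t = 2s≤t
-- `lcm-valuation` only refutes that no level is divisible by the prime power and produces no such
-- level. The inequality is therefore decided first, and each such level contradicts its failure.
... | no 2s≰t = contradiction
  (λ { ℓ (Q , inQ , level) p^∣ℓ →
       2s≰t (valuation-bound p pp k vdet (level-bound p pp G rank k Q ℓ inQ level p^∣ℓ)) })
  (lcm-valuation p pp lcm k vL)
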